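{- For every integer $d\geq 3$ there exist an infinite set $\mathcal{N}$ of positive integers and a function $\varepsilon:\mathcal{N}\to\mathbb{R}$ with $\varepsilon(N)\to 0$ as $N\to\infty$ in $\mathcal{N}$, such that for every $N\in\mathcal{N}$, \[ T(d,N) \geq \left((1-\varepsilon(N))\frac{N^{d-1}}{e^d}\right)^{N}, \] where $T(d,N)$ denotes the maximum number of transversals in an order-$N$ $d$-dimensional Latin hypercube.
   Context: An order-$N$ $d$-dimensional Latin hypercube is represented as a $0$-$1$ array $A:[N]^{d+1}\to\{0,1\}$ such that every line contains exactly one $1$; here a line is a set of tuples obtained by fixing all but one of the $d+1$ indices and letting the remaining index range over $[N]$. (Equivalently, an $[N]^d$ array over $[N]$ in which every symbol appears exactly once in each line.) A $1$-element of $A$ is a tuple $(i_1,\dots,i_{d+1})$ with $A(i_1,\dots,i_{d+1})=1$. A hyperplane of $A$ is a set of tuples obtained by fixing one of the $d+1$ indices and letting the other $d$ range over $[N]$. A transversal of $A$ is a set of $N$ $1$-elements of $A$ containing exactly one element from each hyperplane. -}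

module Defs where

open import Data.Nat as ℕ using (ℕ; zero; suc; _!)
open import Data.Nat.Properties using (_!≢0)
open import Data.Integer using (+_)
open import Data.Fin using (Fin)
open import Data.Vec using (Vec; lookup; _[_]≔_)
open import Data.Bool using (Bool; true)
open import Data.Product using (Σ; _×_; ∃)
open import Data.Rational as ℚ using (ℚ; _/_; _*_; _+_; 0ℚ; 1ℚ)
open import Relation.Binary.PropositionalEquality using (_≡_; _≢_)
open import Relation.Nullary using (¬_)

ExactlyOne : {A : Set} → (A → Set) → Set
ExactlyOne {A} P = Σ A λ a → P a × (∀ b → P b → b ≡ a)

Tuple : ℕ → ℕ → Set
Tuple d N = Vec (Fin N) (suc d)

Array : ℕ → ℕ → Set
Array d N = Tuple d N → Bool

IsLatinHypercube : {d N : ℕ} → Array d N → Set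
IsLatinHypercube {d} {N} A =
  (k : Fin (suc d)) (x : Tuple d N) → ExactlyOne (λ (v : Fin N) → A (x [ k ]≔ v) ≡ true)

TupleSet : ℕ → ℕ → Set
TupleSet d N = Tuple d N → Bool

-- A transversal: a set of 1-elements containing exactly one element from each
-- hyperplane { x | x_k = v }.  (It then automatically has exactly N elements.)
IsTransversal : {d N : ℕ} → Array d N → TupleSet d N → Set
IsTransversal {d} {N} A S =
  ((x : Tuple d N) → S x ≡ true → A x ≡ true) ×
  ((k : Fin (suc d)) (v : Fin N) →
     ExactlyOne (λ (x : Tuple d N) → S x ≡ true × lookup x k ≡ v))

HasAtLeastTransversals : {d N : ℕ} → Array d N → ℕ → Set
HasAtLeastTransversals {d} {N} A m =
  Σ (Fin m → TupleSet d N) λ F →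
    ((i : Fin m) → IsTransversal A (F i)) ×
    ((i j : Fin m) → i ≢ j → ∃ λ (x : Tuple d N) → F i x ≢ F j x)

TAtLeast : ℕ → ℕ → ℕ → Set
TAtLeast d N m = Σ (Array d N) λ A → IsLatinHypercube A × HasAtLeastTransversals A m

fromℕ : ℕ → ℚ
fromℕ n = + n / 1

infixr 8 _^ℚ_
_^ℚ_ : ℚ → ℕ → ℚ
q ^ℚ zero = 1ℚ
q ^ℚ suc n = q * (q ^ℚ n)

expPartial : ℚ → ℕ → ℚ
expPartial x zero = 0ℚ
expPartial x (suc j) = expPartial x j + (x ^ℚ j) * (_/_ (+ 1) (j !) {{j !≢0}})

-- The real inequality  m ≥ (b / e^d)^N , i.e.  m · e^{dN} ≥ b^N , for rational b,
-- expressed via e^{dN} = sup_j Σ_{i<j} (dN)^i / i!.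
AtLeastOverExpPow : (m : ℕ) (b : ℚ) (d N : ℕ) → Set
AtLeastOverExpPow m b d N =
  ∃ λ (j : ℕ) → b ^ℚ N ℚ.≤ fromℕ m * expPartial (fromℕ (d ℕ.* N)) j

{-# OPTIONS --safe #-}
module Submission where

-- Order-N hypercubes are built from blocks: N = b n with n = b^(d-1) s, the quotients of the coordinates
-- by n obey addition mod b, and inside block p the remainders obey
-- σ_p(z) = τ_p(x) + y_1 + ... + y_{d-1} (mod n) for permutations σ_p, τ_p of Fin n.  Only tuples of
-- permutations with exactly s positions in each of the b^d blocks are counted, which costs a factor
-- subexponential in N.  For such a configuration and a block p, choosing the s values of τ_p one after
-- the other shows that a proportion at least ((1 - 2s/n)/n)^s of all pairs (σ_p, τ_p) fits it, so the
-- pigeonhole principle, applied block by block, yields pairs fitting a proportion (1 - o(1))^N n^(-N)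
-- of all configurations; s grows so that n^(1/s) → 1, and s/n = b^(1-d) → 0.

-- With one block only, two permutations would have to be prescribed at all positions, and the
-- successive choice of values breaks down halfway: each chosen value rules out up to two others.
-- Prescribing only s = n/q positions per block, q = b^(d-1), leaves at least n - 2s values at every
-- choice. The target arises as follows. A configuration consists of d + 1 coordinates, each made of
-- b permutations of n inner values, up to relabelling the s points of every block. There are
-- (n!)^(b(d+1)) / (s!)^(b^d) of them, roughly q^N (n/e)^(dN), and the factor n^(-N) turns this into
-- (q n^(d-1) / e^d)^N = (N^(d-1) / e^d)^N. The number e enters without Stirling's formula:
-- (n!)^(bd) is at least (dN)! / (db)^(dN), because a multinomial coefficient is at most the number
-- of all words, and e^(dN) is at least its series term (dN)^(dN) / (dN)!. The two factorials (dN)!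
-- cancel.

-- Counting in lists: pigeonhole, disjoint unions, products

module Counting where

  open import Data.Nat using (ℕ; zero; suc; _+_; _*_; _^_; _≤_; z≤n; s≤s)
  open import Data.Nat.Properties
  open import Data.List using (List; []; _∷_; _++_; map; length; filter; lookup; cartesianProductWith)
  open import Data.List.Properties using (length-map; length-++)
  open import Data.Nat.ListAction using (sum)
  open import Data.List.Membership.Propositional using (_∈_)
  open import Data.List.Membership.Propositional.Properties
  open import Data.List.Relation.Unary.Any using (here; there; index)
  open import Data.List.Relation.Unary.Any.Properties using (lookup-index)
  open import Data.Fin using (Fin; zero; suc)
  open import Data.Fin.Properties using (injective⇒≤)
  open import Algebra.Properties.CommutativeSemigroup +-commutativeSemigroup using (x∙yz≈y∙xz)
  open import Algebra.Properties.CommutativeSemigroup *-commutativeSemigroup using (xy∙z≈xz∙y; xy∙z≈x∙zy)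
  import Data.List.Relation.Unary.All as All
  open import Data.List.Relation.Unary.AllPairs using ([]; _∷_)
  open import Data.List.Relation.Unary.Unique.Propositional using (Unique)
  import Data.List.Relation.Unary.Unique.Propositional.Properties as Uniq
  open import Data.Product using (Σ; ∃; _×_; _,_; proj₁; proj₂)
  open import Data.Sum using (inj₁; inj₂)
  open import Data.Empty using (⊥-elim)
  open import Function using (_∘_; id)
  open import Relation.Nullary using (Dec; yes; no; ¬?; _×-dec_)
  open import Relation.Unary using (Decidable)
  open import Relation.Binary.Definitions using (DecidableEquality)
  open import Relation.Binary.PropositionalEquality

  private
    variable
      A B : Set

  count : {P : A → Set} → Decidable P → List A → ℕ
  count P? xs = length (filter P? xs)

  count-mono : {P R : A → Set} (P? : Decidable P) (R? : Decidable R) →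
    (∀ x → P x → R x) → ∀ xs → count P? xs ≤ count R? xs
  count-mono P? R? P⇒R [] = z≤n
  count-mono P? R? P⇒R (x ∷ xs) with P? x | R? x
  ... | yes p | yes r = s≤s (count-mono P? R? P⇒R xs)
  ... | yes p | no ¬r = ⊥-elim (¬r (P⇒R x p))
  ... | no ¬p | yes r = m≤n⇒m≤1+n (count-mono P? R? P⇒R xs)
  ... | no ¬p | no ¬r = count-mono P? R? P⇒R xs

  count-split : {P R : A → Set} (P? : Decidable P) (R? : Decidable R) → ∀ xs →
    count P? xs ≡ count (λ x → P? x ×-dec R? x) xs + count P? (filter (¬? ∘ R?) xs)
  count-split P? R? [] = refl
  count-split P? R? (x ∷ xs) with R? x
  ... | yes r with P? x
  ...   | yes p = cong suc (count-split P? R? xs)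
  ...   | no ¬p = count-split P? R? xs
  count-split P? R? (x ∷ xs) | no ¬r with P? x
  ...   | yes p = trans (cong suc (count-split P? R? xs)) (sym (+-suc _ _))
  ...   | no ¬p = count-split P? R? xs

  count-++ : {P : A → Set} (P? : Decidable P) → ∀ xs ys →
    count P? (xs ++ ys) ≡ count P? xs + count P? ys
  count-++ P? [] ys = refl
  count-++ P? (x ∷ xs) ys with P? x
  ... | yes _ = cong suc (count-++ P? xs ys)
  ... | no _ = count-++ P? xs ys

  count-map : {P : B → Set} (P? : Decidable P) (f : A → B) → ∀ xs →
    count P? (map f xs) ≡ count (P? ∘ f) xs
  count-map P? f [] = refl
  count-map P? f (x ∷ xs) with P? (f x)
  ... | yes _ = cong suc (count-map P? f xs)
  ... | no _ = count-map P? f xs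

  sum-map-≤-max : (f : B → ℕ) (b : B) (xs : List B) → ∃ λ x → sum (map f xs) ≤ f x * length xs
  sum-map-≤-max f b [] = b , z≤n
  sum-map-≤-max f b (x ∷ xs) with sum-map-≤-max f b xs
  ... | y , le with ≤-total (f x) (f y)
  ...   | inj₁ x≤y = y , ≤-trans (+-mono-≤ x≤y le) (≤-reflexive (sym (*-suc (f y) _)))
  ...   | inj₂ y≤x = x , ≤-trans (+-monoʳ-≤ (f x) (≤-trans le (*-monoˡ-≤ (length xs) y≤x)))
                          (≤-reflexive (sym (*-suc (f x) _)))

  module _ {R : A → B → Set} (R? : ∀ a b → Dec (R a b)) where

    sum-count-∷ : ∀ a as bs →
      sum (map (λ b → count (λ a′ → R? a′ b) (a ∷ as)) bs)
        ≡ count (R? a) bs + sum (map (λ b → count (λ a′ → R? a′ b) as) bs)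
    sum-count-∷ a as [] = refl
    sum-count-∷ a as (b ∷ bs) with R? a b
    ... | yes _ = cong suc (trans (cong (m +_) (sum-count-∷ a as bs)) (x∙yz≈y∙xz m (count (R? a) bs) _))
      where m = count (λ a′ → R? a′ b) as
    ... | no _ = trans (cong (m +_) (sum-count-∷ a as bs)) (x∙yz≈y∙xz m (count (R? a) bs) _)
      where m = count (λ a′ → R? a′ b) as

    sum-count-≥ : ∀ (g : ℕ) as bs → (∀ a → a ∈ as → g ≤ count (R? a) bs) →
      length as * g ≤ sum (map (λ b → count (λ a → R? a b) as) bs)
    sum-count-≥ g [] bs h = z≤n
    sum-count-≥ g (a ∷ as) bs h = ≤-trans
      (+-mono-≤ (h a (here refl)) (sum-count-≥ g as bs (λ a′ → h a′ ∘ there)))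
      (≤-reflexive (sym (sum-count-∷ a as bs)))

    -- Double counting: the related pairs number at least `length as * g`, and some `b` takes at
    -- least its average share of them. `b₀` answers the case of an empty `bs`.
    pigeonhole : ∀ (g : ℕ) as bs → B → (∀ a → a ∈ as → g ≤ count (R? a) bs) →
      ∃ λ b → length as * g ≤ count (λ a → R? a b) as * length bs
    pigeonhole g as bs b₀ h with sum-map-≤-max (λ b → count (λ a → R? a b) as) b₀ bs
    ... | b , le = b , ≤-trans (sum-count-≥ g as bs h) le

  -- The lower bound `g` holds for each single `a`, so it survives the passage to a sublist. The
  -- indices can therefore be treated one after another, each costing the same factor
  -- `g / length bs`.
  pigeonholes : ∀ k {R : Fin k → A → B → Set} (R? : ∀ i a b → Dec (R i a b)) (g : ℕ)
    {as : List A} (bs : List B) → B → (∀ i a → a ∈ as → g ≤ count (R? i a) bs) → Unique as →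
    Σ (Fin k → B) λ f → Σ (List A) λ as′ →
      Unique as′ × (∀ {a} → a ∈ as′ → a ∈ as) × (∀ i {a} → a ∈ as′ → R i a (f i)) ×
      length as * g ^ k ≤ length as′ * length bs ^ k
  pigeonholes zero R? g {as} bs b₀ h u = (λ ()) , as , u , id , (λ ()) , ≤-refl
  pigeonholes {A = A} {B = B} (suc k) {R} R? g {as} bs b₀ h u
    with b , le ← pigeonhole (R? zero) g as bs b₀ (h zero)
    with f , as′ , u′ , sub , r , le′ ← pigeonholes k (R? ∘ suc) g bs b₀
           (λ i a → h (suc i) a ∘ proj₁ ∘ ∈-filter⁻ (λ a → R? zero a b) {xs = as}) (Uniq.filter⁺ (λ a → R? zero a b) u)
    = f⁺ , as′ , u′ , proj₁ ∘ ∈-filter⁻ (λ a → R? zero a b) ∘ sub , r⁺ , (begin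
      length as * (g * g ^ k)             ≡⟨ *-assoc (length as) g _ ⟨
      length as * g * g ^ k               ≤⟨ *-monoˡ-≤ (g ^ k) le ⟩
      c * length bs * g ^ k               ≡⟨ xy∙z≈xz∙y c (length bs) (g ^ k) ⟩
      c * g ^ k * length bs               ≤⟨ *-monoˡ-≤ (length bs) le′ ⟩
      length as′ * length bs ^ k * length bs ≡⟨ xy∙z≈x∙zy (length as′) (length bs ^ k) (length bs) ⟩
      length as′ * (length bs * length bs ^ k) ∎)
    where
    open ≤-Reasoning
    c = count (λ a → R? zero a b) as
    f⁺ : Fin (suc k) → B
    f⁺ zero = b
    f⁺ (suc i) = f i
    r⁺ : ∀ i {a} → a ∈ as′ → R i a (f⁺ i)
    r⁺ zero a∈ = proj₂ (∈-filter⁻ (λ a → R? zero a b) {xs = as} (sub a∈))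
    r⁺ (suc i) = r i

  lookup-injective : {xs : List A} → Unique xs → ∀ i j → lookup xs i ≡ lookup xs j → i ≡ j
  lookup-injective (_ ∷ _) zero zero _ = refl
  lookup-injective (x∉ ∷ _) zero (suc j) eq = ⊥-elim (All.lookup x∉ (∈-lookup j) eq)
  lookup-injective (x∉ ∷ _) (suc i) zero eq = ⊥-elim (All.lookup x∉ (∈-lookup i) (sym eq))
  lookup-injective (_ ∷ u) (suc i) (suc j) eq = cong suc (lookup-injective u i j eq)

  length-⊆ : {xs ys : List A} → Unique xs → (∀ {x} → x ∈ xs → x ∈ ys) → length xs ≤ length ys
  length-⊆ {xs = xs} {ys} u sub = injective⇒≤ {f = f} f-injective
    where
    f : Fin (length xs) → Fin (length ys)
    f i = index (sub (∈-lookup i))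
    f-injective : ∀ {i j} → f i ≡ f j → i ≡ j
    f-injective {i} {j} eq = lookup-injective u i j
      (trans (lookup-index (sub (∈-lookup i)))
             (trans (cong (lookup ys) eq) (sym (lookup-index (sub (∈-lookup j))))))

  module _ (_≟_ : DecidableEquality A) where
    open import Data.List.Membership.DecPropositional _≟_ using (_∉?_; _∈?_)

    length-∉ : ∀ ys {xs} → Unique xs → length xs ≤ length ys + count (_∉? ys) xs
    length-∉ ys {xs} u = ≤-trans (≤-reflexive (split xs))
      (+-monoˡ-≤ _ (length-⊆ (Uniq.filter⁺ (_∈? ys) u) (proj₂ ∘ ∈-filter⁻ (_∈? ys) {xs = xs})))
      where
      split : ∀ zs → length zs ≡ count (_∈? ys) zs + count (_∉? ys) zs
      split [] = refl
      split (z ∷ zs) with z ∈? ys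
      ... | yes _ = cong suc (split zs)
      ... | no _ = trans (cong suc (split zs)) (sym (+-suc _ _))

  -- The elements related to the head are split off and removed before the recursion. By
  -- disjointness (`keep`) this removes nothing that is related to another `c`, so the lower bound
  -- `g` persists for the tail.
  count-disjoint : {R : B → A → Set} (R? : ∀ b → Decidable (R b)) {P : A → Set} (P? : Decidable P)
    (g : ℕ) {bs : List B} → Unique bs → (as : List A) →
    (∀ b → b ∈ bs → g ≤ count (R? b) as) → (∀ b a → b ∈ bs → R b a → P a) →
    (∀ b c a → R b a → R c a → b ≡ c) → length bs * g ≤ count P? as
  count-disjoint R? P? g [] as _ _ _ = z≤n
  count-disjoint {R = R} R? P? g {b ∷ bs} (b∉ ∷ u) as many good disj = begin
    g + length bs * g
      ≤⟨ +-mono-≤ (≤-trans (many b (here refl)) (count-mono (R? b) PR? (λ a r → good b a (here refl) r , r) as))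
                  (count-disjoint R? P? g u as′ many′ (λ c a → good c a ∘ there) disj) ⟩
    count PR? as + count P? as′ ≡⟨ count-split P? (R? b) as ⟨
    count P? as ∎
    where
    open ≤-Reasoning
    PR? = λ a → P? a ×-dec R? b a
    as′ = filter (¬? ∘ R? b) as
    keep : ∀ c → c ≢ b → ∀ as → count (R? c) as ≤ count (R? c) (filter (¬? ∘ R? b) as)
    keep c c≢b [] = z≤n
    keep c c≢b (a ∷ as) with R? b a
    ... | no _ with R? c a
    ...   | yes _ = s≤s (keep c c≢b as)
    ...   | no _ = keep c c≢b as
    keep c c≢b (a ∷ as) | yes r with R? c a
    ...   | yes r′ = ⊥-elim (c≢b (disj c b a r′ r))
    ...   | no _ = keep c c≢b as
    many′ : ∀ c → c ∈ bs → g ≤ count (R? c) as′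
    many′ c c∈ = ≤-trans (many c (there c∈)) (keep c (All.lookup b∉ c∈ ∘ sym) as)

  length-cartesianProductWith : {C : Set} (f : A → B → C) (xs : List A) (ys : List B) →
    length (cartesianProductWith f xs ys) ≡ length xs * length ys
  length-cartesianProductWith f [] ys = refl
  length-cartesianProductWith f (x ∷ xs) ys = trans (length-++ (map (f x) ys))
    (cong₂ _+_ (length-map (f x) ys) (length-cartesianProductWith f xs ys))

-- Permutations with prescribed values

module Permutations where

  open Counting
  open import Data.Nat using (ℕ; zero; suc; _*_; _^_; _∸_; _≤_; z≤n; s≤s; _!)
  open import Data.Nat.Properties hiding (_≟_; suc-injective)
  open import Data.Unit using (⊤; tt)
  open import Data.Maybe using (Maybe; just; nothing)
  open import Data.Fin using (Fin; zero; suc; punchIn; punchOut)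
  open import Data.Fin.Properties using (_≟_; all?; any?; punchIn-punchOut; punchIn-injective; suc-injective)
  open import Data.Fin.Permutation as Perm using (Permutation′; _⟨$⟩ʳ_; insert; insert-punchIn)
  open import Data.List using (List; []; _∷_; map; length; cartesianProduct; cartesianProductWith; allFin; tabulate)
  open import Data.List.Properties using (length-tabulate)
  open import Data.List.Membership.Propositional using (_∈_)
  open import Data.List.Membership.Propositional.Properties
  open import Data.List.Relation.Unary.Any using (here; there)
  import Data.List.Relation.Unary.All as All
  open import Data.List.Relation.Unary.AllPairs using ([]; _∷_)
  open import Data.List.Relation.Unary.Unique.Propositional using (Unique)
  import Data.List.Relation.Unary.Unique.Propositional.Properties as Uniq
  open import Data.Vec using (Vec; []; _∷_)
  open import Data.Vec.Properties using (∷-injective)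
  open import Data.Product using (∃; _×_; _,_; swap)
  open import Data.Sum using (_⊎_; inj₁; inj₂)
  open import Data.Empty using (⊥-elim)
  open import Function using (_∘_; id; case_of_)
  open import Function.Definitions using (Injective)
  open import Relation.Nullary using (contradiction; Dec; yes; no)
  open import Relation.Unary using (Decidable)
  open import Relation.Binary.PropositionalEquality

  private
    variable
      A B : Set
      m n s : ℕ

  module _ {n : ℕ} where
    open import Data.List.Membership.DecPropositional (_≟_ {n}) public using (_∉?_; _∈?_)

  -- The head is chosen last, so that `count-cartesianProductWith` can bound the number of heads
  -- that extend a given tail.
  vecs : List A → ∀ k → List (Vec A k)
  vecs xs zero = [] ∷ []
  vecs xs (suc k) = cartesianProductWith (λ v x → x ∷ v) (vecs xs k) xs

  vecs-unique : {xs : List A} → Unique xs → ∀ k → Unique (vecs xs k)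
  vecs-unique u zero = All.[] ∷ []
  vecs-unique u (suc k) =
    Uniq.cartesianProductWith⁺ _ (swap ∘ ∷-injective) (vecs-unique u k) u

  length-vecs : ∀ (xs : List A) k → length (vecs xs k) ≡ length xs ^ k
  length-vecs xs zero = refl
  length-vecs xs (suc k) = trans (length-cartesianProductWith _ (vecs xs k) xs)
    (trans (cong (_* length xs) (length-vecs xs k)) (*-comm _ (length xs)))

  -- Rule of product: which second components are good may depend on the first, only their number
  -- needs a uniform bound.
  count-cartesianProductWith : {C : Set} {Q : A → Set} {P : C → Set} (Q? : Decidable Q) (P? : Decidable P)
    (f : A → B → C) (g : ℕ) (xs : List A) (ys : List B) →
    (∀ x → Q x → g ≤ count (P? ∘ f x) ys) →
    count Q? xs * g ≤ count P? (cartesianProductWith f xs ys)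
  count-cartesianProductWith Q? P? f g [] ys h = z≤n
  count-cartesianProductWith Q? P? f g (x ∷ xs) ys h
    rewrite count-++ P? (map (f x) ys) (cartesianProductWith f xs ys) | count-map P? (f x) ys with Q? x
  ... | yes q = +-mono-≤ (h x q) (count-cartesianProductWith Q? P? f g xs ys h)
  ... | no _ = ≤-trans (count-cartesianProductWith Q? P? f g xs ys h) (m≤n+m _ _)

  -- Permutation′ n does not have the right propositional equality, hence codes.
  Code : ℕ → Set
  Code zero = ⊤
  Code (suc n) = Fin (suc n) × Code n

  -- A Lehmer code: `j` is the image of zero, and `c` encodes the bijection that remains when zero
  -- and `j` are deleted.
  ⟦_⟧ : Code n → Permutation′ n
  ⟦_⟧ {zero} _ = Perm.id
  ⟦_⟧ {suc n} (j , c) = insert zero j ⟦ c ⟧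

  ⟦⟧-injective : ∀ {n} (c d : Code n) → (∀ i → ⟦ c ⟧ ⟨$⟩ʳ i ≡ ⟦ d ⟧ ⟨$⟩ʳ i) → c ≡ d
  ⟦⟧-injective {zero} tt tt _ = refl
  ⟦⟧-injective {suc n} (j , c) (k , d) eq with refl ← eq zero =
    cong (j ,_) (⟦⟧-injective c d λ i → punchIn-injective j _ _
      (trans (sym (insert-punchIn zero j ⟦ c ⟧ i)) (trans (eq (suc i)) (insert-punchIn zero j ⟦ d ⟧ i))))

  codes : ∀ n → List (Code n)
  codes zero = tt ∷ []
  codes (suc n) = cartesianProduct (allFin (suc n)) (codes n)

  codes-unique : ∀ n → Unique (codes n)
  codes-unique zero = All.[] ∷ []
  codes-unique (suc n) = Uniq.cartesianProduct⁺ (Uniq.allFin⁺ (suc n)) (codes-unique n)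

  length-codes : ∀ n → length (codes n) ≡ n !
  length-codes zero = refl
  length-codes (suc n) = trans (length-cartesianProductWith _,_ (allFin (suc n)) (codes n))
    (cong₂ _*_ (length-tabulate {n = suc n} id) (length-codes n))

  idCode : ∀ n → Code n
  idCode zero = tt
  idCode (suc n) = zero , idCode n

  !-mono-≤ : m ≤ n → m ! ≤ n !
  !-mono-≤ {n = n} z≤n = 1≤n! n
  !-mono-≤ (s≤s m≤n) = *-mono-≤ (s≤s m≤n) (!-mono-≤ m≤n)

  values : (Fin m → Maybe A) → List A
  values {zero} g = []
  values {suc m} g with g zero
  ... | just v = v ∷ values (g ∘ suc)
  ... | nothing = values (g ∘ suc)

  values-cases : (g : Fin (suc m) → Maybe A) →
    (∃ λ v → g zero ≡ just v × values g ≡ v ∷ values (g ∘ suc)) ⊎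
    (g zero ≡ nothing × values g ≡ values (g ∘ suc))
  values-cases g with g zero
  ... | just v = inj₁ (v , refl , refl)
  ... | nothing = inj₂ (refl , refl)

  length-values : (g : Fin m → Maybe A) → length (values g) ≤ m
  length-values {zero} g = z≤n
  length-values {suc m} g with g zero
  ... | just v = s≤s (length-values (g ∘ suc))
  ... | nothing = m≤n⇒m≤1+n (length-values (g ∘ suc))

  ∈-values : (g : Fin m → Maybe A) (i : Fin m) {v : A} → g i ≡ just v → v ∈ values g
  ∈-values g zero eq with g zero | eq
  ... | just v | refl = here refl
  ∈-values g (suc i) eq with g zero
  ... | just v = there (∈-values (g ∘ suc) i eq)
  ... | nothing = ∈-values (g ∘ suc) i eq

  values-∈ : (g : Fin m → Maybe A) {v : A} → v ∈ values g → ∃ λ i → g i ≡ just v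
  values-∈ {suc m} g v∈ with g zero in eq
  values-∈ {suc m} g (here refl) | just v = zero , eq
  values-∈ {suc m} g (there v∈) | just v with i , e ← values-∈ (g ∘ suc) v∈ = suc i , e
  values-∈ {suc m} g v∈ | nothing with i , e ← values-∈ (g ∘ suc) v∈ = suc i , e

  PartialInjective : (Fin m → Maybe A) → Set
  PartialInjective g = ∀ {i j v} → g i ≡ just v → g j ≡ just v → i ≡ j

  values-unique : (g : Fin m → Maybe A) → PartialInjective g → Unique (values g)
  values-unique {zero} g inj = []
  values-unique {suc m} g inj with g zero in eq
  ... | just v = All.tabulate (λ {w} w∈ v≡w → case values-∈ (g ∘ suc) w∈ of λ where
                     (i , e) → contradiction (inj (trans eq (cong just v≡w)) e) λ ())
                 ∷ values-unique (g ∘ suc) (λ p q → suc-injective (inj p q))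
    where open import Function using (case_of_)
  ... | nothing = values-unique (g ∘ suc) (λ p q → suc-injective (inj p q))

  MatchAt : Maybe (Fin n) → Fin n → Set
  MatchAt nothing w = ⊤
  MatchAt (just v) w = w ≡ v

  matchAt? : (x : Maybe (Fin n)) (w : Fin n) → Dec (MatchAt x w)
  matchAt? nothing w = yes tt
  matchAt? (just v) w = w ≟ v

  Match : (Fin n → Maybe (Fin n)) → Code n → Set
  Match g c = ∀ i → MatchAt (g i) (⟦ c ⟧ ⟨$⟩ʳ i)

  match? : (g : Fin n → Maybe (Fin n)) → Decidable (Match g)
  match? g c = all? λ i → matchAt? (g i) (⟦ c ⟧ ⟨$⟩ʳ i)

  -- A prescribed value, renumbered once `j` has been used up as the image of zero. The value `j`
  -- itself becomes `nothing`; this default does no harm, because `match-delete` assumes that no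
  -- later position prescribes `j`.
  delete : Fin (suc n) → Maybe (Fin (suc n)) → Maybe (Fin n)
  delete j nothing = nothing
  delete j (just w) with j ≟ w
  ... | yes _ = nothing
  ... | no j≢w = just (punchOut j≢w)

  delete-just : (j : Fin (suc n)) (x : Maybe (Fin (suc n))) {v : Fin n} → delete j x ≡ just v → x ≡ just (punchIn j v)
  delete-just j (just w) eq with j ≟ w
  delete-just j (just w) refl | no j≢w = cong just (sym (punchIn-punchOut j≢w))

  delete-injective : (j : Fin (suc n)) (g : Fin m → Maybe (Fin (suc n))) →
    PartialInjective g → PartialInjective (delete j ∘ g)
  delete-injective j g inj {i} {k} p q = inj (delete-just j (g i) p) (delete-just j (g k) q)

  length-values-delete : (j : Fin (suc n)) (g : Fin m → Maybe (Fin (suc n))) →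
    length (values (delete j ∘ g)) ≤ length (values g)
  length-values-delete {m = zero} j g = z≤n
  length-values-delete {m = suc m} j g with g zero
  ... | nothing = length-values-delete j (g ∘ suc)
  ... | just w with j ≟ w
  ...   | yes _ = m≤n⇒m≤1+n (length-values-delete j (g ∘ suc))
  ...   | no _ = s≤s (length-values-delete j (g ∘ suc))

  match-delete : (g : Fin (suc n) → Maybe (Fin (suc n))) (j : Fin (suc n)) (c : Code n) →
    MatchAt (g zero) j → (∀ i → g (suc i) ≢ just j) → Match (delete j ∘ g ∘ suc) c → Match g (j , c)
  match-delete g j c m₀ avoid m zero = m₀
  match-delete g j c m₀ avoid m (suc i) with g (suc i) | avoid i | m i
  ... | nothing | _ | _ = tt
  ... | just w | j≢w | mᵢ with j ≟ w
  ...   | yes refl = ⊥-elim (j≢w refl)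
  ...   | no ¬eq = trans (insert-punchIn zero j ⟦ c ⟧ i) (trans (cong (punchIn j) mᵢ) (punchIn-punchOut ¬eq))

  -- Induction along the code. If zero has a prescribed image, there is one choice for it, and the
  -- numbers of positions and of prescriptions both drop by one. Otherwise every value outside the k
  -- prescribed ones is possible, which supplies the factor suc n - k of the larger factorial.
  count-match : ∀ n (g : Fin n → Maybe (Fin n)) → PartialInjective g →
    (n ∸ length (values g)) ! ≤ count (match? g) (codes n)
  count-match-delete : ∀ n (g : Fin (suc n) → Maybe (Fin (suc n))) → PartialInjective g → ∀ j →
    MatchAt (g zero) j → (∀ i → g (suc i) ≢ just j) →
    (n ∸ length (values (g ∘ suc))) ! ≤ count (match? g ∘ (j ,_)) (codes n)
  count-match-delete n g inj j m₀ avoid = begin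
    (n ∸ length (values (g ∘ suc))) !
      ≤⟨ !-mono-≤ (∸-monoʳ-≤ n (length-values-delete j (g ∘ suc))) ⟩
    (n ∸ length (values (delete j ∘ g ∘ suc))) !
      ≤⟨ count-match n (delete j ∘ g ∘ suc) (delete-injective j (g ∘ suc) λ p q → suc-injective (inj p q)) ⟩
    count (match? (delete j ∘ g ∘ suc)) (codes n)
      ≤⟨ count-mono (match? (delete j ∘ g ∘ suc)) (match? g ∘ (j ,_)) (λ c → match-delete g j c m₀ avoid) (codes n) ⟩
    count (match? g ∘ (j ,_)) (codes n) ∎
    where open ≤-Reasoning
  count-match zero g inj = ≤-refl
  count-match (suc n) g inj with values-cases g
  ... | inj₁ (v , eq , eqᵥ) = begin
    (suc n ∸ length (values g)) ! ≡⟨ cong (λ l → (suc n ∸ length l) !) eqᵥ ⟩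
    (n ∸ k) !       ≡⟨ *-identityˡ _ ⟨
    1 * (n ∸ k) !
      ≤⟨ *-monoˡ-≤ ((n ∸ k) !) (∈-length (∈-filter⁺ (_≟ v) (∈-allFin v) refl)) ⟩
    count (_≟ v) (allFin (suc n)) * (n ∸ k) !
      ≤⟨ count-cartesianProductWith (_≟ v) (match? g) _,_ _ (allFin (suc n)) (codes n)
           (λ { _ refl → count-match-delete n g inj v (subst (λ x → MatchAt x v) (sym eq) refl)
                  (λ i e → contradiction (inj eq e) λ ()) }) ⟩
    count (match? g) (codes (suc n)) ∎
    where
    open ≤-Reasoning
    k = length (values (g ∘ suc))
  ... | inj₂ (eq , eqᵥ) = begin
    (suc n ∸ length (values g)) ! ≡⟨ cong (λ l → (suc n ∸ length l) !) eqᵥ ⟩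
    (suc n ∸ k) !   ≡⟨ cong _! (+-∸-assoc 1 (length-values (g ∘ suc))) ⟩
    suc (n ∸ k) * (n ∸ k) !
      ≤⟨ *-monoˡ-≤ ((n ∸ k) !) (≤-trans (≤-reflexive (sym (+-∸-assoc 1 (length-values (g ∘ suc)))))
           (m≤n+o⇒m∸n≤o (suc n) k (≤-trans (≤-reflexive (sym (length-tabulate {n = suc n} id)))
              (length-∉ _≟_ vs (Uniq.allFin⁺ (suc n)))))) ⟩
    count (_∉? vs) (allFin (suc n)) * (n ∸ k) !
      ≤⟨ count-cartesianProductWith (_∉? vs) (match? g) _,_ _ (allFin (suc n)) (codes n)
           (λ j j∉ → count-match-delete n g inj j (subst (λ x → MatchAt x j) (sym eq) tt)
                  (λ i e → j∉ (∈-values (g ∘ suc) i e))) ⟩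
    count (match? g) (codes (suc n)) ∎
    where
    open ≤-Reasoning
    vs = values (g ∘ suc)
    k = length vs

  Prescribed : (x v : Fin s → Fin n) → Code n → Set
  Prescribed x v c = ∀ t → ⟦ c ⟧ ⟨$⟩ʳ x t ≡ v t

  prescribed? : (x v : Fin s → Fin n) → Decidable (Prescribed x v)
  prescribed? x v c = all? λ t → ⟦ c ⟧ ⟨$⟩ʳ x t ≟ v t

  -- The two sequences are merged into one partial function `g` with at most s values, found by
  -- searching for i among the `x t`. It is well defined as `x` is injective and injective as `v`
  -- is, so `count-match` applies.
  count-prescribed : (x v : Fin s → Fin n) → Injective _≡_ _≡_ x → Injective _≡_ _≡_ v →
    (n ∸ s) ! ≤ count (prescribed? x v) (codes n)
  count-prescribed {s} {n} x v x-inj v-inj = begin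
    (n ∸ s) !                   ≤⟨ !-mono-≤ (∸-monoʳ-≤ n few) ⟩
    (n ∸ length (values g)) !   ≤⟨ count-match n g g-inj ⟩
    count (match? g) (codes n)  ≤⟨ count-mono (match? g) (prescribed? x v) sound (codes n) ⟩
    count (prescribed? x v) (codes n) ∎
    where
    open ≤-Reasoning
    g : Fin n → Maybe (Fin n)
    g i with any? (λ t → x t ≟ i)
    ... | yes (t , _) = just (v t)
    ... | no _ = nothing
    g-just : ∀ i {w} → g i ≡ just w → ∃ λ t → x t ≡ i × v t ≡ w
    g-just i eq with any? (λ t → x t ≟ i)
    g-just i refl | yes (t , e) = t , e , refl
    g-x : ∀ t → g (x t) ≡ just (v t)
    g-x t with any? (λ t′ → x t′ ≟ x t)
    ... | yes (t′ , e) = cong (just ∘ v) (x-inj e)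
    ... | no ¬e = ⊥-elim (¬e (t , refl))
    g-inj : PartialInjective g
    g-inj {i} {j} p q with t , refl , refl ← g-just i p with u , refl , e ← g-just j q = cong x (v-inj (sym e))
    few : length (values g) ≤ s
    few = ≤-trans (length-⊆ {ys = tabulate v} (values-unique g g-inj) sub) (≤-reflexive (length-tabulate v))
      where
      sub : ∀ {w} → w ∈ values g → w ∈ tabulate v
      sub w∈ with i , e ← values-∈ g w∈ with t , _ , refl ← g-just i e = ∈-tabulate⁺ t
    sound : ∀ c → Match g c → Prescribed x v c
    sound c m t with g (x t) | g-x t | m (x t)
    ... | .(just (v t)) | refl | e = e

-- Pairs of permutations satisfying s equations

module Matching where

  open Counting
  open Permutations
  open import Data.Nat using (ℕ; zero; suc; _+_; _*_; _^_; _∸_; _≤_; z≤n; s≤s; _!)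
  open import Data.Nat.Properties hiding (_≟_; suc-injective)
  open import Data.Fin using (Fin; zero; suc)
  open import Data.Fin.Properties using (_≟_; all?)
  open import Data.Fin.Permutation using (_⟨$⟩ʳ_)
  open import Data.List using (List; []; _∷_; map; length; filter; cartesianProduct; allFin; tabulate)
  open import Data.List.Properties using (length-map; length-tabulate)
  open import Data.List.Membership.Propositional using (_∈_; _∉_)
  open import Data.List.Membership.Propositional.Properties
  import Data.List.Relation.Unary.Unique.Propositional.Properties as Uniq
  open import Data.Vec using (Vec; []; _∷_; lookup)
  open import Data.Vec.Properties using (tabulate∘lookup; tabulate-cong)
  open import Data.Product using (_×_; _,_; proj₂)
  open import Function using (_∘_; id)
  open import Function.Definitions using (Injective)
  open import Relation.Nullary using (contradiction; Dec; yes; no; _×-dec_; _→-dec_)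
  open import Relation.Unary using (Decidable)
  open import Relation.Binary.PropositionalEquality

  private
    variable
      A B : Set
      m n s : ℕ

  count-filter : {P Q R : A → Set} (P? : Decidable P) (Q? : Decidable Q) (R? : Decidable R) →
    (∀ x → Q x → P x → R x) → ∀ xs → count P? (filter Q? xs) ≤ count R? xs
  count-filter P? Q? R? h [] = z≤n
  count-filter P? Q? R? h (x ∷ xs) with Q? x
  ... | no _ with R? x
  ...   | yes _ = m≤n⇒m≤1+n (count-filter P? Q? R? h xs)
  ...   | no _ = count-filter P? Q? R? h xs
  count-filter P? Q? R? h (x ∷ xs) | yes q with P? x | R? x
  ... | yes p | yes r = s≤s (count-filter P? Q? R? h xs)
  ... | yes p | no ¬r = contradiction (h x q p) ¬r
  ... | no _ | yes _ = m≤n⇒m≤1+n (count-filter P? Q? R? h xs)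
  ... | no _ | no _ = count-filter P? Q? R? h xs

  InjectiveFin : (Fin s → Fin n) → Set
  InjectiveFin h = ∀ i j → h i ≡ h j → i ≡ j

  injective? : (h : Fin s → Fin n) → Dec (InjectiveFin h)
  injective? h = all? λ i → all? λ j → (h i ≟ h j) →-dec (i ≟ j)

  InjectiveFin-∷ : (h : Fin (suc s) → Fin n) → h zero ∉ tabulate (h ∘ suc) → InjectiveFin (h ∘ suc) → InjectiveFin h
  InjectiveFin-∷ h h₀∉ inj zero zero _ = refl
  InjectiveFin-∷ h h₀∉ inj zero (suc j) eq = contradiction (subst (_∈ tabulate (h ∘ suc)) (sym eq) (∈-tabulate⁺ j)) h₀∉
  InjectiveFin-∷ h h₀∉ inj (suc i) zero eq = contradiction (subst (_∈ tabulate (h ∘ suc)) eq (∈-tabulate⁺ i)) h₀∉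
  InjectiveFin-∷ h h₀∉ inj (suc i) (suc j) eq = cong suc (inj i j eq)

  -- The admissible values of τ at s positions: τ takes the values `v t`, hence the first condition,
  -- and σ takes the values `f t (v t)`, hence the second.
  Transported : (Fin s → Fin n → Fin n) → Vec (Fin n) s → Set
  Transported f v = InjectiveFin (lookup v) × InjectiveFin (λ t → f t (lookup v t))

  transported? : (f : Fin s → Fin n → Fin n) → Decidable (Transported f)
  transported? f v = injective? (lookup v) ×-dec injective? (λ t → f t (lookup v t))

  -- A new head has to avoid the s values in the tail and the preimages under `f zero` of the s
  -- transported values, at most 2s in all.
  count-transported-∷ : (f : Fin (suc s) → Fin n → Fin n) → Injective _≡_ _≡_ (f zero) →
    ∀ v → Transported (f ∘ suc) v → n ∸ (s + s) ≤ count (λ w → transported? f (w ∷ v)) (allFin n)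
  count-transported-∷ {s} {n} f f₀-inj v (v-inj , fv-inj) = m≤n+o⇒m∸n≤o n (s + s) (begin
    n                                                ≡⟨ length-tabulate id ⟨
    length (allFin n)                                ≤⟨ length-∉ _≟_ vs (Uniq.allFin⁺ n) ⟩
    length vs + length free                          ≡⟨ cong₂ _+_ (length-tabulate (lookup v)) (sym (length-map (f zero) free)) ⟩
    s + length (map (f zero) free)                   ≤⟨ +-monoʳ-≤ s (length-∉ _≟_ us
                                                          (Uniq.map⁺ f₀-inj (Uniq.filter⁺ (_∉? vs) (Uniq.allFin⁺ n)))) ⟩
    s + (length us + count (_∉? us) (map (f zero) free))
      ≡⟨ cong (s +_) (cong₂ _+_ (length-tabulate (λ t → f (suc t) (lookup v t))) (count-map (_∉? us) (f zero) free)) ⟩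
    s + (s + count ((_∉? us) ∘ f zero) free)
      ≤⟨ +-monoʳ-≤ s (+-monoʳ-≤ s (count-filter ((_∉? us) ∘ f zero) (_∉? vs) (λ w → transported? f (w ∷ v)) extend (allFin n))) ⟩
    s + (s + count (λ w → transported? f (w ∷ v)) (allFin n)) ≡⟨ +-assoc s s _ ⟨
    s + s + count (λ w → transported? f (w ∷ v)) (allFin n) ∎)
    where
    open ≤-Reasoning
    vs = tabulate (lookup v)
    us = tabulate (λ t → f (suc t) (lookup v t))
    free = filter (_∉? vs) (allFin n)
    extend : ∀ w → w ∉ vs → f zero w ∉ us → Transported f (w ∷ v)
    extend w w∉ fw∉ = InjectiveFin-∷ (lookup (w ∷ v)) w∉ v-inj ,
                      InjectiveFin-∷ (λ t → f t (lookup (w ∷ v) t)) fw∉ fv-inj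

  -- The number of free values shrinks as the sequence grows. Keeping the final length `k` apart
  -- from the running length `s` replaces each factor by the smallest one, and the product becomes a
  -- power.
  count-transported : ∀ k s → s ≤ k → (f : Fin s → Fin n → Fin n) → (∀ t → Injective _≡_ _≡_ (f t)) →
    (n ∸ (k + k)) ^ s ≤ count (transported? f) (vecs (allFin n) s)
  count-transported k zero _ f f-inj with transported? f []
  ... | yes _ = s≤s z≤n
  ... | no ¬p = contradiction ((λ ()) , (λ ())) ¬p
  count-transported {n} k (suc s) s<k f f-inj = begin
    (n ∸ (k + k)) * (n ∸ (k + k)) ^ s
      ≡⟨ *-comm (n ∸ (k + k)) _ ⟩
    (n ∸ (k + k)) ^ s * (n ∸ (k + k))
      ≤⟨ *-mono-≤ (count-transported k s (<⇒≤ s<k) (f ∘ suc) (f-inj ∘ suc))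
                  (∸-monoʳ-≤ n (+-mono-≤ (<⇒≤ s<k) (<⇒≤ s<k))) ⟩
    count (transported? (f ∘ suc)) (vecs (allFin n) s) * (n ∸ (s + s))
      ≤⟨ count-cartesianProductWith (transported? (f ∘ suc)) (transported? f) (λ v x → x ∷ v) _ (vecs (allFin n) s) (allFin n)
           (count-transported-∷ f (f-inj zero)) ⟩
    count (transported? f) (vecs (allFin n) (suc s)) ∎
    where open ≤-Reasoning

  Matched : (Fin s → Fin n → Fin n) → (x z : Fin s → Fin n) → Code n × Code n → Set
  Matched f x z (τ , σ) = ∀ t → f t (⟦ τ ⟧ ⟨$⟩ʳ x t) ≡ ⟦ σ ⟧ ⟨$⟩ʳ z t

  matched? : (f : Fin s → Fin n → Fin n) (x z : Fin s → Fin n) → Decidable (Matched f x z)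
  matched? f x z (τ , σ) = all? λ t → f t (⟦ τ ⟧ ⟨$⟩ʳ x t) ≟ ⟦ σ ⟧ ⟨$⟩ʳ z t

  codePairs : ∀ n → List (Code n × Code n)
  codePairs n = cartesianProduct (codes n) (codes n)

  length-codePairs : ∀ n → length (codePairs n) ≡ n ! * n !
  length-codePairs n = trans (length-cartesianProductWith _,_ (codes n) (codes n))
    (cong₂ _*_ (length-codes n) (length-codes n))

  -- Every admissible sequence `v` is realised by at least ((n - s)!)^2 pairs, by prescribing `v` to
  -- τ and its transport to σ. Different sequences give disjoint sets of pairs, since `v` can be
  -- read off from τ.
  count-matched : (f : Fin s → Fin n → Fin n) (x z : Fin s → Fin n) →
    (∀ t → Injective _≡_ _≡_ (f t)) → Injective _≡_ _≡_ x → Injective _≡_ _≡_ z →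
    (n ∸ (s + s)) ^ s * ((n ∸ s) ! * (n ∸ s) !) ≤ count (matched? f x z) (codePairs n)
  count-matched {s} {n} f x z f-inj x-inj z-inj = begin
    (n ∸ (s + s)) ^ s * g
      ≤⟨ *-monoˡ-≤ g (count-transported s s ≤-refl f f-inj) ⟩
    length vs * g
      ≤⟨ count-disjoint R? (matched? f x z) g (Uniq.filter⁺ (transported? f) (vecs-unique (Uniq.allFin⁺ n) s))
           (codePairs n) many sound disjoint ⟩
    count (matched? f x z) (codePairs n) ∎
    where
    open ≤-Reasoning
    g = (n ∸ s) ! * (n ∸ s) !
    vs = filter (transported? f) (vecs (allFin n) s)
    R : Vec (Fin n) s → Code n × Code n → Set
    R v (τ , σ) = Prescribed x (lookup v) τ × Prescribed z (λ t → f t (lookup v t)) σ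
    R? : ∀ v → Decidable (R v)
    R? v (τ , σ) = prescribed? x (lookup v) τ ×-dec prescribed? z (λ t → f t (lookup v t)) σ
    many : ∀ v → v ∈ vs → g ≤ count (R? v) (codePairs n)
    many v v∈ with v-inj , fv-inj ← proj₂ (∈-filter⁻ (transported? f) {xs = vecs (allFin n) s} v∈) = begin
      (n ∸ s) ! * (n ∸ s) !
        ≤⟨ *-monoˡ-≤ ((n ∸ s) !) (count-prescribed x (lookup v) x-inj (v-inj _ _)) ⟩
      count (prescribed? x (lookup v)) (codes n) * (n ∸ s) !
        ≤⟨ count-cartesianProductWith (prescribed? x (lookup v)) (R? v) _,_ _ (codes n) (codes n)
             (λ τ p → ≤-trans (count-prescribed z (λ t → f t (lookup v t)) z-inj (fv-inj _ _))
                        (count-mono (prescribed? z (λ t → f t (lookup v t))) (λ σ → R? v (τ , σ)) (λ σ q → p , q) (codes n))) ⟩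
      count (R? v) (codePairs n) ∎
    sound : ∀ v c → v ∈ vs → R v c → Matched f x z c
    sound v (τ , σ) _ (p , q) t = trans (cong (f t) (p t)) (sym (q t))
    disjoint : ∀ v w c → R v c → R w c → v ≡ w
    disjoint v w (τ , σ) (p , _) (q , _) = trans (sym (tabulate∘lookup v))
      (trans (tabulate-cong (λ t → trans (sym (p t)) (q t))) (tabulate∘lookup w))

-- Words with equally frequent letters

module Words where

  open Counting
  open import Data.Nat using (ℕ; zero; suc; _+_; _*_; _^_; _!)
  open import Data.Nat.Properties hiding (_≟_; suc-injective)
  open import Data.Nat.Tactic.RingSolver using (solve-∀)
  open import Data.Unit using (⊤; tt)
  open import Data.Fin using (Fin; zero; suc)
  open import Data.Fin.Properties using (suc-injective)
  open import Data.List using (List; []; _∷_; _++_; map; length; cartesianProduct)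
  open import Data.List.Properties using (length-map; length-++)
  open import Data.List.Membership.Propositional.Properties
  import Data.List.Relation.Unary.All as All
  open import Data.List.Relation.Unary.AllPairs using ([]; _∷_)
  open import Data.List.Relation.Unary.Unique.Propositional using (Unique)
  import Data.List.Relation.Unary.Unique.Propositional.Properties as Uniq
  open import Data.Product using (_×_; _,_; proj₁; proj₂)
  open import Data.Sum using (_⊎_; inj₁; inj₂; map₁; map₂)
  open import Data.Bool using (Bool; true; false)
  open import Function using (_∘_)
  open import Relation.Nullary using (contradiction)
  open import Relation.Binary.PropositionalEquality

  private
    variable
      k a b q s : ℕ

  -- A pattern for interleaving a and b positions. The total k is an index of its own instead of a +
  -- b, so that both constructors have indices in constructor form; the type is empty unless k = a +
  -- b.
  data Shuffle : ℕ → ℕ → ℕ → Set where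
    done : Shuffle zero zero zero
    left : Shuffle k a b → Shuffle (suc k) (suc a) b
    right : Shuffle k a b → Shuffle (suc k) a (suc b)

  split : Shuffle k a b → Fin k → Fin a ⊎ Fin b
  split (left w) zero = inj₁ zero
  split (left w) (suc i) = map₁ suc (split w i)
  split (right w) zero = inj₂ zero
  split (right w) (suc i) = map₂ suc (split w i)

  merge : Shuffle k a b → Fin a ⊎ Fin b → Fin k
  merge (left w) (inj₁ zero) = zero
  merge (left w) (inj₁ (suc x)) = suc (merge w (inj₁ x))
  merge (left w) (inj₂ y) = suc (merge w (inj₂ y))
  merge (right w) (inj₁ x) = suc (merge w (inj₁ x))
  merge (right w) (inj₂ zero) = zero
  merge (right w) (inj₂ (suc y)) = suc (merge w (inj₂ y))

  split-merge : (w : Shuffle k a b) (x : Fin a ⊎ Fin b) → split w (merge w x) ≡ x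
  split-merge (left w) (inj₁ zero) = refl
  split-merge (left w) (inj₁ (suc x)) = cong (map₁ suc) (split-merge w (inj₁ x))
  split-merge (left w) (inj₂ y) = cong (map₁ suc) (split-merge w (inj₂ y))
  split-merge (right w) (inj₁ x) = cong (map₂ suc) (split-merge w (inj₁ x))
  split-merge (right w) (inj₂ zero) = refl
  split-merge (right w) (inj₂ (suc y)) = cong (map₂ suc) (split-merge w (inj₂ y))

  merge-split : (w : Shuffle k a b) (i : Fin k) → merge w (split w i) ≡ i
  merge-split (left w) zero = refl
  merge-split (left w) (suc i) with split w i | merge-split w i
  ... | inj₁ x | eq = cong suc eq
  ... | inj₂ y | eq = cong suc eq
  merge-split (right w) zero = refl
  merge-split (right w) (suc i) with split w i | merge-split w i
  ... | inj₁ x | eq = cong suc eq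
  ... | inj₂ y | eq = cong suc eq

  isLeft : {A B : Set} → A ⊎ B → Bool
  isLeft (inj₁ _) = true
  isLeft (inj₂ _) = false

  isLeft-map₁ : {A B C : Set} (f : A → C) (x : A ⊎ B) → isLeft (map₁ f x) ≡ isLeft x
  isLeft-map₁ f (inj₁ _) = refl
  isLeft-map₁ f (inj₂ _) = refl

  isLeft-map₂ : {A B C : Set} (f : B → C) (x : A ⊎ B) → isLeft (map₂ f x) ≡ isLeft x
  isLeft-map₂ f (inj₁ _) = refl
  isLeft-map₂ f (inj₂ _) = refl

  split-injective : (w w′ : Shuffle k a b) → (∀ i → isLeft (split w i) ≡ isLeft (split w′ i)) → w ≡ w′
  split-injective done done eq = refl
  split-injective (left w) (left w′) eq = cong left (split-injective w w′ λ i →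
    trans (sym (isLeft-map₁ suc (split w i))) (trans (eq (suc i)) (isLeft-map₁ suc (split w′ i))))
  split-injective (right w) (right w′) eq = cong right (split-injective w w′ λ i →
    trans (sym (isLeft-map₂ suc (split w i))) (trans (eq (suc i)) (isLeft-map₂ suc (split w′ i))))
  split-injective (left w) (right w′) eq with () ← eq zero
  split-injective (right w) (left w′) eq with () ← eq zero

  shuffles : ∀ k a b → List (Shuffle k a b)
  shuffles zero zero zero = done ∷ []
  shuffles zero zero (suc b) = []
  shuffles zero (suc a) b = []
  shuffles (suc k) zero zero = []
  shuffles (suc k) (suc a) zero = map left (shuffles k a zero)
  shuffles (suc k) zero (suc b) = map right (shuffles k zero b)
  shuffles (suc k) (suc a) (suc b) = map left (shuffles k a (suc b)) ++ map right (shuffles k (suc a) b)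

  left-injective : {w w′ : Shuffle k a b} → left w ≡ left w′ → w ≡ w′
  left-injective refl = refl

  right-injective : {w w′ : Shuffle k a b} → right w ≡ right w′ → w ≡ w′
  right-injective refl = refl

  shuffles-unique : ∀ k a b → Unique (shuffles k a b)
  shuffles-unique zero zero zero = All.[] ∷ []
  shuffles-unique zero zero (suc b) = []
  shuffles-unique zero (suc a) b = []
  shuffles-unique (suc k) zero zero = []
  shuffles-unique (suc k) (suc a) zero = Uniq.map⁺ left-injective (shuffles-unique k a zero)
  shuffles-unique (suc k) zero (suc b) = Uniq.map⁺ right-injective (shuffles-unique k zero b)
  shuffles-unique (suc k) (suc a) (suc b) = Uniq.++⁺
    (Uniq.map⁺ left-injective (shuffles-unique k a (suc b)))
    (Uniq.map⁺ right-injective (shuffles-unique k (suc a) b))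
    λ (p , q) → contradiction (∈-map⁻ left p) λ { (_ , _ , refl) → contradiction (∈-map⁻ right q) λ () }

  -- Pascal's rule with the denominators cleared: the patterns starting with `left` contribute suc a
  -- * k ! and the others suc b * k !.
  length-shuffles : ∀ k a b → k ≡ a + b → length (shuffles k a b) * (a ! * b !) ≡ k !
  length-shuffles zero zero zero eq = refl
  length-shuffles (suc k) (suc a) zero refl = begin
    length (map left (shuffles k a 0)) * (suc a * a ! * 1)
      ≡⟨ cong (_* (suc a * a ! * 1)) (length-map left (shuffles k a 0)) ⟩
    l * (suc a * a ! * 1)     ≡⟨ regroup l (suc a) (a !) ⟩
    suc a * (l * (a ! * 1))   ≡⟨ cong (suc a *_) (length-shuffles k a 0 refl) ⟩
    suc a * k !               ≡⟨ cong (λ x → suc x * k !) (sym (+-identityʳ a)) ⟩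
    suc k * k ! ∎
    where
    open ≡-Reasoning
    l = length (shuffles k a 0)
    regroup : ∀ l c x → l * (c * x * 1) ≡ c * (l * (x * 1))
    regroup = solve-∀
  length-shuffles (suc k) zero (suc b) refl = begin
    length (map right (shuffles k 0 b)) * (1 * (suc b * b !))
      ≡⟨ cong (_* (1 * (suc b * b !))) (length-map right (shuffles k 0 b)) ⟩
    l * (1 * (suc b * b !))   ≡⟨ regroup l (suc b) (b !) ⟩
    suc b * (l * (1 * b !))   ≡⟨ cong (suc b *_) (length-shuffles k 0 b refl) ⟩
    suc b * b ! ∎
    where
    open ≡-Reasoning
    l = length (shuffles k 0 b)
    regroup : ∀ l c x → l * (1 * (c * x)) ≡ c * (l * (1 * x))
    regroup = solve-∀
  length-shuffles (suc k) (suc a) (suc b) eq = begin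
    length (map left (shuffles k a (suc b)) ++ map right (shuffles k (suc a) b)) * (suc a * a ! * (suc b * b !))
      ≡⟨ cong (_* (suc a * a ! * (suc b * b !))) (trans (length-++ (map left (shuffles k a (suc b))))
           (cong₂ _+_ (length-map left (shuffles k a (suc b))) (length-map right (shuffles k (suc a) b)))) ⟩
    (l + r) * (suc a * a ! * (suc b * b !))
      ≡⟨ regroup l r (suc a) (a !) (suc b) (b !) ⟩
    suc a * (l * (a ! * (suc b * b !))) + suc b * (r * (suc a * a ! * b !))
      ≡⟨ cong₂ (λ x y → suc a * x + suc b * y)
           (length-shuffles k a (suc b) (cong pred eq)) (length-shuffles k (suc a) b (cong pred (trans eq (+-suc (suc a) b)))) ⟩
    suc a * k ! + suc b * k !  ≡⟨ *-distribʳ-+ (k !) (suc a) (suc b) ⟨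
    (suc a + suc b) * k !      ≡⟨ cong (_* k !) eq ⟨
    suc k * k ! ∎
    where
    open ≡-Reasoning
    open import Data.Nat using (pred)
    l = length (shuffles k a (suc b))
    r = length (shuffles k (suc a) b)
    regroup : ∀ l r c x d y → (l + r) * (c * x * (d * y)) ≡ c * (l * (x * (d * y))) + d * (r * (c * x * y))
    regroup = solve-∀

  -- A word over the alphabet Fin q with every letter occurring s times.
  Word : ℕ → ℕ → Set
  Word zero s = ⊤
  Word (suc q) s = Shuffle (suc q * s) s (q * s) × Word q s

  -- The letter at a position, together with the number of this occurrence among all occurrences of
  -- the letter, in increasing order of position.
  cell : Word q s → Fin (q * s) → Fin q × Fin s
  cell {suc q} (w , ws) i with split w i
  ... | inj₁ t = zero , t
  ... | inj₂ j = suc (proj₁ (cell ws j)) , proj₂ (cell ws j)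

  place : Word q s → Fin q → Fin s → Fin (q * s)
  place {suc q} (w , ws) zero t = merge w (inj₁ t)
  place {suc q} (w , ws) (suc e) t = merge w (inj₂ (place ws e t))

  cell-place : (w : Word q s) (e : Fin q) (t : Fin s) → cell w (place w e t) ≡ (e , t)
  cell-place {suc q} (w , ws) zero t rewrite split-merge w (inj₁ t) = refl
  cell-place {suc q} (w , ws) (suc e) t rewrite split-merge w (inj₂ (place ws e t)) | cell-place ws e t = refl

  place-cell : (w : Word q s) (i : Fin (q * s)) → place w (proj₁ (cell w i)) (proj₂ (cell w i)) ≡ i
  place-cell {suc q} (w , ws) i with split w i | merge-split w i
  ... | inj₁ t | eq = eq
  ... | inj₂ j | eq = trans (cong (merge w ∘ inj₂) (place-cell ws j)) eq

  cell-isLeft : (w w′ : Word (suc q) s) → (∀ i → proj₁ (cell w i) ≡ proj₁ (cell w′ i)) →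
    ∀ i → isLeft (split (proj₁ w) i) ≡ isLeft (split (proj₁ w′) i)
  cell-isLeft (w , _) (w′ , _) eq i with split w i | split w′ i | eq i
  ... | inj₁ _ | inj₁ _ | _ = refl
  ... | inj₂ _ | inj₂ _ | _ = refl

  -- The positions of the first letter determine the outer shuffle, and the other letters determine
  -- the rest by induction. Only letters are compared, because a transversal, being a set, does not
  -- show how the points of a block are numbered.
  cell-injective : (w w′ : Word q s) → (∀ i → proj₁ (cell w i) ≡ proj₁ (cell w′ i)) → w ≡ w′
  cell-injective {zero} tt tt _ = refl
  cell-injective {suc q} {s} (w , ws) (w′ , ws′) eq
    with refl ← split-injective w w′ (cell-isLeft (w , ws) (w′ , ws′) eq) = cong (w ,_) (cell-injective ws ws′ tails)
    where
    tails : ∀ j → proj₁ (cell ws j) ≡ proj₁ (cell ws′ j)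
    tails j with split w (merge w (inj₂ j)) | split-merge w (inj₂ j) | eq (merge w (inj₂ j))
    ... | .(inj₂ j) | refl | e = suc-injective e

  words : ∀ q s → List (Word q s)
  words zero s = tt ∷ []
  words (suc q) s = cartesianProduct (shuffles (suc q * s) s (q * s)) (words q s)

  words-unique : ∀ q s → Unique (words q s)
  words-unique zero s = All.[] ∷ []
  words-unique (suc q) s = Uniq.cartesianProduct⁺ (shuffles-unique (suc q * s) s (q * s)) (words-unique q s)

  length-words : ∀ q s → length (words q s) * (s !) ^ q ≡ (q * s) !
  length-words zero s = refl
  length-words (suc q) s = begin
    length (words (suc q) s) * (s ! * (s !) ^ q)
      ≡⟨ cong (_* (s ! * (s !) ^ q)) (length-cartesianProductWith _,_ (shuffles (suc q * s) s (q * s)) (words q s)) ⟩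
    l * length (words q s) * (s ! * (s !) ^ q)   ≡⟨ regroup l (length (words q s)) (s !) ((s !) ^ q) ⟩
    l * (s ! * (length (words q s) * (s !) ^ q)) ≡⟨ cong (λ x → l * (s ! * x)) (length-words q s) ⟩
    l * (s ! * (q * s) !)                      ≡⟨ length-shuffles (suc q * s) s (q * s) refl ⟩
    (suc q * s) ! ∎
    where
    open ≡-Reasoning
    l = length (shuffles (suc q * s) s (q * s))
    regroup : ∀ l m x y → l * m * (x * y) ≡ l * (x * (m * y))
    regroup = solve-∀

-- The Latin hypercube assembled from blocks

module Hypercube where

  open import Defs
  open Counting
  open Permutations
  open Matching
  open Words
  open import Data.Nat using (ℕ; zero; suc; _+_; _*_; _^_; _∸_; NonZero)
  open import Data.Nat.Properties as ℕₚ using (+-comm; +-assoc; m+[n∸m]≡n; <⇒≤)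
  open import Data.Nat.DivMod using (_%_; _mod_; %-distribˡ-+; m%n%n≡m%n; [m+n]%n≡m%n; m<n⇒m%n≡m; m%n<n)
  open import Data.Fin using (Fin; zero; suc; toℕ; combine; quotient; remainder; remQuot)
  open import Data.Fin.Properties using (_≟_; toℕ-injective; toℕ<n; toℕ-fromℕ<; remQuot-combine; combine-remQuot)
  open import Data.Fin.Permutation using (_⟨$⟩ʳ_; _⟨$⟩ˡ_; inverseˡ; inverseʳ)
  open import Data.Vec using (Vec; []; _∷_; map; _[_]≔_)
  open import Data.Vec.Properties using (map-[]≔)
  open import Data.Bool using (true)
  open import Data.Product using (_×_; _,_; proj₁; proj₂; uncurry)
  open import Function using (_∘_; id)
  open import Function.Definitions using (Injective)
  open import Relation.Nullary using (Dec; yes; does; _×-dec_)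
  open import Relation.Nullary.Decidable using (dec-true)
  open import Relation.Unary using (Decidable)
  open import Relation.Binary.PropositionalEquality

  private
    variable
      A B C : Set
      b k m n s : ℕ

  -- Bijectivity, phrased by `ExactlyOne` so that it feeds directly into the conditions on lines and
  -- hyperplanes.
  Solvable : (A → B) → Set
  Solvable {B = B} f = (y : B) → ExactlyOne (λ x → f x ≡ y)

  solvable : {f : A → B} (g : B → A) → (∀ y → f (g y) ≡ y) → (∀ x → g (f x) ≡ x) → Solvable f
  solvable g fg gf y = g y , fg y , λ { x refl → sym (gf x) }

  solvable-∘ : {f : B → C} {g : A → B} → Solvable f → Solvable g → Solvable (f ∘ g)
  solvable-∘ {g = g} f-sol g-sol z with f-sol z
  ... | y , fy , y! with g-sol y
  ...   | x , refl , x! = x , fy , λ x′ e → x! x′ (y! (g x′) e)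

  solvable-injective : {f : A → B} → Solvable f → Injective _≡_ _≡_ f
  solvable-injective {f = f} f-sol {x} {y} eq with f-sol (f y)
  ... | _ , _ , u = trans (u x eq) (sym (u y refl))

  ExactlyOne-⇔ : {P R : A → Set} → (∀ a → P a → R a) → (∀ a → R a → P a) → ExactlyOne P → ExactlyOne R
  ExactlyOne-⇔ to from (a , p , u) = a , to a p , λ b r → u b (from b r)

  does⇒ : {P : Set} (P? : Dec P) → does P? ≡ true → P
  does⇒ (yes p) _ = p

  %-+-% : ∀ i j m .{{_ : NonZero m}} → (i % m + j) % m ≡ (i + j) % m
  %-+-% i j m = begin
    (i % m + j) % m             ≡⟨ %-distribˡ-+ (i % m) j m ⟩
    (i % m % m + j % m) % m     ≡⟨ cong (λ x → (x + j % m) % m) (m%n%n≡m%n i m) ⟩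
    (i % m + j % m) % m         ≡⟨ %-distribˡ-+ i j m ⟨
    (i + j) % m ∎
    where open ≡-Reasoning

  _⊕_ : Fin m → Fin m → Fin m
  _⊕_ {suc m} x y = (toℕ x + toℕ y) mod suc m

  _⊖_ : Fin m → Fin m → Fin m
  _⊖_ {suc m} x y = (toℕ x + (suc m ∸ toℕ y)) mod suc m

  toℕ-mod : ∀ i m .{{_ : NonZero m}} → toℕ (i mod m) ≡ i % m
  toℕ-mod i m = toℕ-fromℕ< (m%n<n i m)

  ⊕-comm : (x y : Fin m) → x ⊕ y ≡ y ⊕ x
  ⊕-comm {suc m} x y = cong (_mod suc m) (+-comm (toℕ x) (toℕ y))

  %-cancel : (x : Fin (suc m)) (i j : ℕ) → i + j ≡ suc m → ((toℕ x + i) % suc m + j) % suc m ≡ toℕ x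
  %-cancel {m} x i j i+j≡m = begin
    ((toℕ x + i) % suc m + j) % suc m   ≡⟨ %-+-% (toℕ x + i) j (suc m) ⟩
    (toℕ x + i + j) % suc m             ≡⟨ cong (_% suc m) (trans (+-assoc (toℕ x) i j) (cong (toℕ x +_) i+j≡m)) ⟩
    (toℕ x + suc m) % suc m             ≡⟨ [m+n]%n≡m%n (toℕ x) (suc m) ⟩
    toℕ x % suc m                       ≡⟨ m<n⇒m%n≡m (toℕ<n x) ⟩
    toℕ x ∎
    where open ≡-Reasoning

  mod-mod : (x : Fin (suc m)) (i j : ℕ) → i + j ≡ suc m → (toℕ ((toℕ x + i) mod suc m) + j) mod suc m ≡ x
  mod-mod {m} x i j i+j≡m = toℕ-injective (trans (toℕ-mod (toℕ ((toℕ x + i) mod suc m) + j) (suc m))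
    (trans (cong (λ l → (l + j) % suc m) (toℕ-mod (toℕ x + i) (suc m))) (%-cancel x i j i+j≡m)))

  ⊖-⊕ : (x y : Fin m) → (x ⊖ y) ⊕ y ≡ x
  ⊖-⊕ {suc m} x y = mod-mod x (suc m ∸ toℕ y) (toℕ y) (ℕₚ.m∸n+n≡m (<⇒≤ (toℕ<n y)))

  ⊕-⊖ : (x y : Fin m) → (x ⊕ y) ⊖ y ≡ x
  ⊕-⊖ {suc m} x y = mod-mod x (toℕ y) (suc m ∸ toℕ y) (m+[n∸m]≡n (<⇒≤ (toℕ<n y)))

  ⊕ˡ-solvable : (y : Fin m) → Solvable (_⊕ y)
  ⊕ˡ-solvable y = solvable (_⊖ y) (λ x → ⊖-⊕ x y) (λ x → ⊕-⊖ x y)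

  ⊕ʳ-solvable : (x : Fin m) → Solvable (x ⊕_)
  ⊕ʳ-solvable x = solvable (_⊖ x) (λ y → trans (⊕-comm x _) (⊖-⊕ y x))
    (λ y → trans (cong (_⊖ x) (⊕-comm x y)) (⊕-⊖ y x))

  Σ⊕ : Fin m → Vec (Fin m) k → Fin m
  Σ⊕ x [] = x
  Σ⊕ x (y ∷ ys) = y ⊕ Σ⊕ x ys

  Σ⊕-head-solvable : (ys : Vec (Fin m) k) → Solvable (λ x → Σ⊕ x ys)
  Σ⊕-head-solvable [] = solvable id (λ _ → refl) (λ _ → refl)
  Σ⊕-head-solvable (y ∷ ys) = solvable-∘ (⊕ʳ-solvable y) (Σ⊕-head-solvable ys)

  Σ⊕-tail-solvable : (x : Fin m) (ys : Vec (Fin m) k) (i : Fin k) → Solvable (λ y → Σ⊕ x (ys [ i ]≔ y))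
  Σ⊕-tail-solvable x (_ ∷ ys) zero = ⊕ˡ-solvable (Σ⊕ x ys)
  Σ⊕-tail-solvable x (y ∷ ys) (suc i) = solvable-∘ (⊕ʳ-solvable y) (Σ⊕-tail-solvable x ys i)

  ⟦⟧-solvable : (c : Code n) → Solvable (⟦ c ⟧ ⟨$⟩ʳ_)
  ⟦⟧-solvable c = solvable (⟦ c ⟧ ⟨$⟩ˡ_) (λ _ → inverseʳ ⟦ c ⟧) (λ _ → inverseˡ ⟦ c ⟧)

  combine-solvable : Solvable (uncurry (combine {m} {n}))
  combine-solvable {m} {n} = solvable (remQuot n) (combine-remQuot {m} n) (uncurry remQuot-combine)

  encode : Vec (Fin b) k → Fin (b ^ k)
  encode [] = zero
  encode (x ∷ xs) = combine x (encode xs)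

  decode : ∀ k → Fin (b ^ k) → Vec (Fin b) k
  decode zero _ = []
  decode {b} (suc k) i = quotient (b ^ k) i ∷ decode k (remainder {b} (b ^ k) i)

  decode-encode : (xs : Vec (Fin b) k) → decode k (encode xs) ≡ xs
  decode-encode [] = refl
  decode-encode {b} {suc k} (x ∷ xs) = cong₂ _∷_
    (cong proj₁ (remQuot-combine {b} {b ^ k} x (encode xs)))
    (trans (cong (decode k ∘ proj₂) (remQuot-combine {b} {b ^ k} x (encode xs))) (decode-encode xs))

  encode-decode : ∀ k (i : Fin (b ^ k)) → encode (decode k i) ≡ i
  encode-decode zero zero = refl
  encode-decode {b} (suc k) i = trans (cong (combine {b} (quotient (b ^ k) i)) (encode-decode {b} k (remainder {b} (b ^ k) i)))
    (combine-remQuot {b} (b ^ k) i)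

  encode-solvable : Solvable (encode {b} {k})
  encode-solvable {b} {k} = solvable (decode k) (encode-decode k) decode-encode

  -- Two-stage solution of an equation on a line: first the quotient is found, and the condition on
  -- the remainder is allowed to depend on it.
  ExactlyOne-combine : {P : Fin m → Set} {R : Fin m → Fin n → Set} → ExactlyOne P →
    (∀ h → P h → ExactlyOne (R h)) →
    ExactlyOne (λ v → P (quotient n v) × R (quotient n v) (remainder {m} n v))
  ExactlyOne-combine {m} {n} {P} {R} (h , p , h!) r with r h p
  ... | l , q , l! = combine h l ,
    subst (λ u → P (proj₁ u) × R (proj₁ u) (proj₂ u)) (sym (remQuot-combine h l)) (p , q) , unique
    where
    unique : ∀ v → P (quotient n v) × R (quotient n v) (remainder {m} n v) → v ≡ combine h l
    unique v (p′ , q′) = trans (sym (combine-remQuot {m} n v)) (cong₂ combine h≡ (l! _ (subst (λ h → R h _) h≡ q′)))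
      where h≡ = h! _ p′

  quotient-combine : (x : Fin m) (y : Fin n) → quotient n (combine x y) ≡ x
  quotient-combine x y = cong proj₁ (remQuot-combine x y)

  remainder-combine : (x : Fin m) (y : Fin n) → remainder {m} n (combine x y) ≡ y
  remainder-combine x y = cong proj₂ (remQuot-combine x y)

  module _ (b n d′ : ℕ) where

    private
      d = suc d′

    outer : Fin (b * n) → Fin b
    outer = quotient n

    inner : Fin (b * n) → Fin n
    inner = remainder {b} n

    -- ρ p = (τ_p , σ_p), and coordinate 0 is the one that is determined by the others.
    OneElement : (Vec (Fin b) d → Code n × Code n) → Tuple d (b * n) → Set
    OneElement ρ (z ∷ x ∷ ys) =
      outer z ≡ Σ⊕ (outer x) (map outer ys) ×
      Σ⊕ (⟦ proj₁ (ρ (outer x ∷ map outer ys)) ⟧ ⟨$⟩ʳ inner x) (map inner ys)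
        ≡ ⟦ proj₂ (ρ (outer x ∷ map outer ys)) ⟧ ⟨$⟩ʳ inner z

    -- Quotients and remainders are separate variables here, so that matching on their equations
    -- replaces rewriting inside the argument of `ρ`.
    oneElement : ∀ ρ {z x ys} h hs {u v us} → outer z ≡ Σ⊕ h hs → outer x ≡ h → map outer ys ≡ hs →
      inner z ≡ v → inner x ≡ u → map inner ys ≡ us →
      Σ⊕ (⟦ proj₁ (ρ (h ∷ hs)) ⟧ ⟨$⟩ʳ u) us ≡ ⟦ proj₂ (ρ (h ∷ hs)) ⟧ ⟨$⟩ʳ v → OneElement ρ (z ∷ x ∷ ys)
    oneElement ρ h hs e refl refl refl refl refl eq = e , eq

    oneElement? : ∀ ρ → Decidable (OneElement ρ)
    oneElement? ρ (z ∷ x ∷ ys) = _ ≟ _ ×-dec _ ≟ _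

    hypercube : (Vec (Fin b) d → Code n × Code n) → Array d (b * n)
    hypercube ρ x = does (oneElement? ρ x)

    -- On a line the sum modulo b determines the moving quotient. With it the block and its two
    -- permutations are fixed, and the inner equation is then a bijection in the moving remainder.
    oneElement-latin : ∀ ρ k x → ExactlyOne (λ v → OneElement ρ (x [ k ]≔ v))
    oneElement-latin ρ zero (z ∷ x ∷ ys) = ExactlyOne-combine
      (_ , refl , λ _ e → e)
      (λ _ _ → ExactlyOne-⇔ (λ _ → sym) (λ _ → sym) (⟦⟧-solvable (proj₂ (ρ (outer x ∷ map outer ys))) _))
    oneElement-latin ρ (suc zero) (z ∷ x ∷ ys) = ExactlyOne-combine
      (ExactlyOne-⇔ (λ _ → sym) (λ _ → sym) (Σ⊕-head-solvable (map outer ys) (outer z)))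
      (λ h _ → solvable-∘ (Σ⊕-head-solvable (map inner ys)) (⟦⟧-solvable (proj₁ (ρ (h ∷ map outer ys))))
        (⟦ proj₂ (ρ (h ∷ map outer ys)) ⟧ ⟨$⟩ʳ inner z))
    oneElement-latin ρ (suc (suc i)) (z ∷ x ∷ ys) = ExactlyOne-⇔
      (λ v → subst₂ (P v) (sym (map-[]≔ outer ys i)) (sym (map-[]≔ inner ys i)))
      (λ v → subst₂ (P v) (map-[]≔ outer ys i) (map-[]≔ inner ys i))
      (ExactlyOne-combine
        (ExactlyOne-⇔ (λ _ → sym) (λ _ → sym) (Σ⊕-tail-solvable (outer x) (map outer ys) i (outer z)))
        (λ h _ → Σ⊕-tail-solvable (⟦ proj₁ (ρ (outer x ∷ (map outer ys [ i ]≔ h))) ⟧ ⟨$⟩ʳ inner x) (map inner ys) i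
          (⟦ proj₂ (ρ (outer x ∷ (map outer ys [ i ]≔ h))) ⟧ ⟨$⟩ʳ inner z)))
      where
      P : Fin (b * n) → Vec (Fin b) d′ → Vec (Fin n) d′ → Set
      P _ os is = outer z ≡ Σ⊕ (outer x) os ×
        Σ⊕ (⟦ proj₁ (ρ (outer x ∷ os)) ⟧ ⟨$⟩ʳ inner x) is ≡ ⟦ proj₂ (ρ (outer x ∷ os)) ⟧ ⟨$⟩ʳ inner z

    hypercube-latin : ∀ ρ → IsLatinHypercube (hypercube ρ)
    hypercube-latin ρ k x = ExactlyOne-⇔
      (λ v → dec-true (oneElement? ρ (x [ k ]≔ v)))
      (λ v → does⇒ (oneElement? ρ (x [ k ]≔ v)))
      (oneElement-latin ρ k x)

-- Configurations and their transversals

module Configurations where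

  open import Defs
  open Counting
  open Permutations
  open Matching
  open Words
  open Hypercube
  open import Data.Nat using (ℕ; zero; suc; _+_; _*_; _^_; _∸_; _≤_; _!)
  open import Data.Nat.Properties as ℕₚ using (^-*-assoc; module ≤-Reasoning)
  open import Data.Fin using (Fin; zero; suc; combine; quotient; remainder)
  open import Data.Fin.Properties using (_≟_; combine-injective; any?)
  open import Data.Fin.Permutation using (_⟨$⟩ʳ_)
  open import Data.List as List using (List; length; cartesianProduct)
  open import Data.List.Membership.Propositional using (_∈_)
  open import Data.List.Relation.Unary.Unique.Propositional using (Unique)
  import Data.List.Relation.Unary.Unique.Propositional.Properties as Uniq
  open import Data.List.Membership.Propositional.Properties using (∈-lookup)
  open import Data.Vec using (Vec; _∷_; lookup; tabulate; tail; insertAt; removeAt)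
  open import Data.Vec.Properties using (≡-dec; lookup∘tabulate; tabulate∘lookup; tabulate-cong; tabulate-∘; insertAt-lookup; removeAt-insertAt; insertAt-removeAt)
  open import Data.Bool using (true)
  open import Data.Product using (Σ; ∃; _×_; _,_; proj₁; proj₂; uncurry)
  open import Function using (_∘_)
  open import Function.Definitions using (Injective)
  open import Relation.Nullary using (¬?; contradiction; Dec; yes; no; does; decidable-stable)
  open import Relation.Nullary.Decidable using (dec-true; map′)
  open import Relation.Unary using (Decidable)
  open import Relation.Binary.PropositionalEquality

  lookup-ext : {A : Set} {k : ℕ} (xs ys : Vec A k) → (∀ i → lookup xs i ≡ lookup ys i) → xs ≡ ys
  lookup-ext xs ys eq = trans (sym (tabulate∘lookup xs)) (trans (tabulate-cong eq) (tabulate∘lookup ys))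

  solvable-map₁ : {A B C : Set} {f : A → B} → Solvable f → Solvable (λ (x : A × C) → f (proj₁ x) , proj₂ x)
  solvable-map₁ f-sol (y , c) with x , refl , u ← f-sol y = (x , c) , refl , λ { (x′ , c′) e → cong₂ _,_ (u x′ (cong proj₁ e)) (cong proj₂ e) }

  solvable-map₂ : {A B C : Set} {f : C → A → B} → (∀ c → Solvable (f c)) → Solvable (λ (x : C × A) → proj₁ x , f (proj₁ x) (proj₂ x))
  solvable-map₂ {f = f} f-sol (c , y) = (c , proj₁ (f-sol c y)) , cong (c ,_) (proj₁ (proj₂ (f-sol c y))) ,
    λ (c′ , x′) e → unique c′ x′ (cong proj₁ e) (cong proj₂ e)
    where
    unique : ∀ c′ x′ → c′ ≡ c → f c′ x′ ≡ y → (c′ , x′) ≡ (c , proj₁ (f-sol c y))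
    unique c′ x′ refl e = cong (c ,_) (proj₂ (proj₂ (f-sol c y)) x′ e)

  module _ (b d′ s : ℕ) where

    private
      d = suc d′
      q = b ^ d′
      n = q * s
      N = b * n
      Block = Vec (Fin b) d

    -- Coordinate 0 gets words instead of permutations, so that relabelling the s positions of a block is not
    -- counted and distinct configurations have distinct transversals.
    Config : Set
    Config = Vec (Word q s) b × Vec (Vec (Code n) b) d

    configs : List Config
    configs = cartesianProduct (vecs (words q s) b) (vecs (vecs (codes n) b) d)

    configs-unique : Unique configs
    configs-unique = Uniq.cartesianProduct⁺ (vecs-unique (words-unique q s) b)
      (vecs-unique (vecs-unique (codes-unique n) b) d)

    length-configs : length configs ≡ length (words q s) ^ b * (n !) ^ (b * d)
    length-configs = trans (length-cartesianProductWith _,_ (vecs (words q s) b) (vecs (vecs (codes n) b) d))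
      (cong₂ _*_ (length-vecs (words q s) b) (trans (length-vecs (vecs (codes n) b) d)
        (trans (cong (_^ d) (trans (length-vecs (codes n) b) (cong (_^ b) (length-codes n)))) (^-*-assoc (n !) b d))))

    -- Σ⊕ p ∷ p is a one-element of the order-b hypercube of blocks; side j is its j-th entry, and rest j keeps
    -- enough of the other entries to recover p.
    side : Fin (suc d) → Block → Fin b
    side zero (x ∷ xs) = Σ⊕ x xs
    side (suc j) p = lookup p j

    rest : Fin (suc d) → Block → Vec (Fin b) d′
    rest zero p = tail p
    rest (suc j) p = removeAt p j

    side-rest-solvable : ∀ j → Solvable (λ p → side j p , rest j p)
    side-rest-solvable zero (h , r) with Σ⊕-head-solvable r h
    ... | x , e , u = x ∷ r , cong (_, r) e , λ { (y ∷ ys) refl → cong (_∷ ys) (u y refl) }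
    side-rest-solvable (suc j) = solvable (λ (h , r) → insertAt r j h)
      (λ (h , r) → cong₂ _,_ (insertAt-lookup r j h) (removeAt-insertAt r j h))
      (λ p → insertAt-removeAt p j)

    -- Exactly q blocks have side `h` in direction `j`. They share the n inner values evenly: the
    -- block numbered `e` receives the s values of `local c j h e`.
    local : Config → Fin (suc d) → Fin b → Fin q → Fin s → Fin n
    local (ws , _) zero h = place (lookup ws h)
    local (_ , πs) (suc j) h e t = ⟦ lookup (lookup πs j) h ⟧ ⟨$⟩ʳ combine e t

    local-solvable : ∀ c j h → Solvable (uncurry (local c j h))
    local-solvable (ws , _) zero h = solvable (cell (lookup ws h)) (place-cell (lookup ws h)) (uncurry (cell-place (lookup ws h)))
    local-solvable (_ , πs) (suc j) h = solvable-∘ (⟦⟧-solvable (lookup (lookup πs j) h)) combine-solvable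

    value : Config → Fin (suc d) → Block → Fin s → Fin n
    value c j p = local c j (side j p) (encode (rest j p))

    coordinate : Config → Fin (suc d) → Block × Fin s → Fin N
    coordinate c j (p , t) = combine (side j p) (value c j p t)

    -- The quotient of an index is the side, its remainder yields the number of the block among
    -- those with this side, and the two together give the block back. This is the condition that
    -- each hyperplane contains exactly one point.
    coordinate-solvable : ∀ c j → Solvable (coordinate c j)
    coordinate-solvable c j = solvable-∘ combine-solvable
      (solvable-∘ (solvable-map₂ λ h → solvable-∘ {g = λ (r , t) → encode r , t} (local-solvable c j h) (solvable-map₁ encode-solvable))
        sides-solvable)
      where
      sides-solvable : Solvable {Block × Fin s} (λ (p , t) → side j p , rest j p , t)
      sides-solvable (h , r , t) with p , refl , u ← side-rest-solvable j (h , r) =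
        (p , t) , refl , λ { (p′ , t′) e → cong₂ _,_ (u p′ (cong (λ (h , r , _) → h , r) e)) (cong (proj₂ ∘ proj₂) e) }

    value-injective : ∀ c j p → Injective _≡_ _≡_ (value c j p)
    value-injective c j p {t} {t′} eq =
      cong proj₂ (solvable-injective (coordinate-solvable c j) {p , t} {p , t′} (cong (combine (side j p)) eq))

    point : Config → Block × Fin s → Tuple d N
    point c i = tabulate (λ j → coordinate c j i)

    lookup-point : ∀ c j i → lookup (point c i) j ≡ coordinate c j i
    lookup-point c j i = lookup∘tabulate (λ j → coordinate c j i) j

    Hits : Config → Tuple d N → Block × Fin s → Set
    Hits c x i = x ≡ point c i

    hits? : ∀ c x → Dec (∃ (Hits c x))
    hits? c x = map′ (λ (i , t , e) → (decode d i , t) , e)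
      (λ ((p , t) , e) → encode p , t , trans e (cong (λ p → point c (p , t)) (sym (decode-encode p))))
      (any? λ i → any? λ t → ≡-dec _≟_ x (point c (decode d i , t)))

    transversal : Config → TupleSet d N
    transversal c x = does (hits? c x)

    -- The last d - 1 coordinates of a point act on the value of τ as a translation; it plays the
    -- part of `f t` in `Matched`.
    shift : Config → Block → Fin s → Fin n → Fin n
    shift c p t w = Σ⊕ w (tabulate (λ j → value c (suc (suc j)) p t))

    Fits : Block → Config → Code n × Code n → Set
    Fits p c = Matched (shift c p) (value c (suc zero) p) (value c zero p)

    fits? : ∀ p c ρ → Dec (Fits p c ρ)
    fits? p c = matched? (shift c p) (value c (suc zero) p) (value c zero p)

    -- The outer equation is built into `side zero`, and the inner one is what `Fits` asserts at t.
    point-oneElement : ∀ ρ c p t → Fits p c (ρ p) → OneElement b n d′ ρ (point c (p , t))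
    point-oneElement ρ c p@(x ∷ xs) t fits = oneElement b n d′ ρ x xs
      (quotient-combine (Σ⊕ x xs) (value c zero p t))
      (quotient-combine x (value c (suc zero) p t))
      (trans (sym (tabulate-∘ (quotient {b} n) others))
        (trans (tabulate-cong λ j → quotient-combine (lookup xs j) (value c (suc (suc j)) p t)) (tabulate∘lookup xs)))
      (remainder-combine (Σ⊕ x xs) (value c zero p t))
      (remainder-combine x (value c (suc zero) p t))
      (trans (sym (tabulate-∘ (remainder {b} n) others))
        (tabulate-cong λ j → remainder-combine (lookup xs j) (value c (suc (suc j)) p t)))
      (fits t)
      where
      others : Fin d′ → Fin N
      others j = coordinate c (suc (suc j)) (p , t)

    transversal-isTransversal : ∀ ρ c → (∀ p → Fits p c (ρ p)) → IsTransversal (hypercube b n d′ ρ) (transversal c)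
    transversal-isTransversal ρ c fits = sound , exact
      where
      sound : ∀ x → transversal c x ≡ true → hypercube b n d′ ρ x ≡ true
      sound x e with (p , t) , refl ← does⇒ (hits? c x) e =
        dec-true (oneElement? b n d′ ρ x) (point-oneElement ρ c p t (fits p))
      exact : ∀ j v → ExactlyOne (λ x → transversal c x ≡ true × lookup x j ≡ v)
      exact j v with i , e , u ← coordinate-solvable c j v =
        point c i , (dec-true (hits? c (point c i)) (i , refl) , trans (lookup-point c j i) e) , unique
        where
        unique : ∀ x → transversal c x ≡ true × lookup x j ≡ v → x ≡ point c i
        unique x (e′ , l) with i′ , refl ← does⇒ (hits? c x) e′ = cong (point c) (u i′ (trans (sym (lookup-point c j i′)) l))

    point-injective : ∀ c c′ {p p′ t t′} → point c (p , t) ≡ point c′ (p′ , t′) →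
      p ≡ p′ × (∀ j → side j p ≡ side j p′ × value c j p t ≡ value c′ j p′ t′)
    point-injective c c′ {p} {p′} {t} {t′} eq = lookup-ext p p′ (proj₁ ∘ both ∘ suc) , both
      where
      both : ∀ j → side j p ≡ side j p′ × value c j p t ≡ value c′ j p′ t′
      both j = combine-injective (side j p) (value c j p t) (side j p′) (value c′ j p′ t′)
        (trans (sym (lookup-point c j (p , t))) (trans (cong (λ x → lookup x j) eq) (lookup-point c′ j (p′ , t′))))

    -- Inclusion of one transversal in another after the blocks have been identified: only the index
    -- inside the block may still differ.
    Covers : Config → Config → Set
    Covers c c′ = ∀ p t → ∃ λ t′ → ∀ j → value c j p t ≡ value c′ j p t′

    hits⇒covers : ∀ c c′ → (∀ i → ∃ (Hits c′ (point c i))) → Covers c c′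
    hits⇒covers c c′ hits p t with (p′ , t′) , eq ← hits (p , t) with refl , both ← point-injective c c′ {p} {p′} {t} {t′} eq =
      t′ , proj₂ ∘ both

    block-of : ∀ j h e → ∃ λ p → side j p ≡ h × encode (rest j p) ≡ e
    block-of j h e with p , eq , _ ← side-rest-solvable j (h , decode d′ e) =
      p , cong proj₁ eq , trans (cong (encode ∘ proj₂) eq) (encode-decode d′ e)

    -- The letter of an inner value of coordinate zero names the block of the point there, and the
    -- block is visible in the point itself.
    covers-words : ∀ ws πs ws′ πs′ → Covers (ws , πs) (ws′ , πs′) → ws ≡ ws′
    covers-words ws πs ws′ πs′ covers = lookup-ext ws ws′ λ h → cell-injective (lookup ws h) (lookup ws′ h) (letters h)
      where
      letters : ∀ h i → proj₁ (cell (lookup ws h) i) ≡ proj₁ (cell (lookup ws′ h) i)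
      letters h i with cell (lookup ws h) i | place-cell (lookup ws h) i
      ... | e , t | refl with p , refl , refl ← block-of zero h e with t′ , eq ← covers p t =
        sym (cong proj₁ (trans (cong (cell (lookup ws′ h)) (eq zero)) (cell-place (lookup ws′ h) (encode (rest zero p)) t′)))

    -- Once the words agree, coordinate zero is the same injective function of t for both
    -- configurations inside a block. This forces t′ = t, and the remaining coordinates can be
    -- compared index by index.
    covers-codes : ∀ ws πs πs′ → Covers (ws , πs) (ws , πs′) → πs ≡ πs′
    covers-codes ws πs πs′ covers = lookup-ext πs πs′ λ j → lookup-ext (lookup πs j) (lookup πs′ j) λ h →
      ⟦⟧-injective (lookup (lookup πs j) h) (lookup (lookup πs′ j) h) (images j h)
      where
      images : ∀ j h i → ⟦ lookup (lookup πs j) h ⟧ ⟨$⟩ʳ i ≡ ⟦ lookup (lookup πs′ j) h ⟧ ⟨$⟩ʳ i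
      images j h i with combine-solvable {q} {s} i
      ... | (e , t) , refl , _ with p , refl , refl ← block-of (suc j) h e with t′ , eq ← covers p t
            with refl ← value-injective (ws , πs) zero p {t} {t′} (eq zero) = eq (suc j)

    transversal-injective : ∀ c c′ → (∀ i → ∃ (Hits c′ (point c i))) → c ≡ c′
    transversal-injective c@(ws , πs) c′@(ws′ , πs′) hits
      with refl ← covers-words ws πs ws′ πs′ (hits⇒covers c c′ hits) = cong (ws ,_) (covers-codes ws πs πs′ (hits⇒covers c c′ hits))

    -- A separating tuple has to be exhibited, so the finitely many points of `c` are searched for
    -- one that `c′` misses. If there is none, one transversal lies in the other, which already
    -- makes the configurations equal.
    transversal-distinct : ∀ c c′ → c ≢ c′ → ∃ λ x → transversal c x ≢ transversal c′ x
    transversal-distinct c c′ c≢c′ with any? (λ i → any? λ t → ¬? (hits? c′ (point c (decode d i , t))))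
    ... | yes (i , t , ¬hit) = x , λ eq → ¬hit (does⇒ (hits? c′ x) (trans (sym eq) (dec-true (hits? c x) ((decode d i , t) , refl))))
      where x = point c (decode d i , t)
    ... | no none = contradiction (transversal-injective c c′ λ (p , t) →
            subst (λ p → ∃ (Hits c′ (point c (p , t)))) (decode-encode p)
              (decidable-stable (hits? c′ (point c (decode d (encode p) , t))) λ ¬hit → none (encode p , t , ¬hit))) c≢c′

    fitting-transversals : (f : Fin (b ^ d) → Code n × Code n) (cs : List Config) → Unique cs →
      (∀ i {c} → c ∈ cs → Fits (decode d i) c (f i)) → TAtLeast d N (length cs)
    fitting-transversals f cs cs-unique fits =
      hypercube b n d′ ρ , hypercube-latin b n d′ ρ ,
      transversal ∘ List.lookup cs ,
      (λ i → transversal-isTransversal ρ (List.lookup cs i) λ p →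
        subst (λ p′ → Fits p′ (List.lookup cs i) (ρ p)) (decode-encode p) (fits (encode p) (∈-lookup i))) ,
      λ i j i≢j → transversal-distinct _ _ (i≢j ∘ lookup-injective cs-unique i j)
      where
      ρ : Block → Code n × Code n
      ρ = f ∘ encode

    fitRate : ℕ
    fitRate = (n ∸ (s + s)) ^ s * ((n ∸ s) ! * (n ∸ s) !)

    count-fits : ∀ p c → fitRate ≤ count (fits? p c) (codePairs n)
    count-fits p c = count-matched (shift c p) (value c (suc zero) p) (value c zero p)
      (λ t → solvable-injective (Σ⊕-head-solvable (tabulate (λ j → value c (suc (suc j)) p t))))
      (value-injective c (suc zero) p) (value-injective c zero p)

    fitting-configs : Σ (Fin (b ^ d) → Code n × Code n) λ f → Σ (List Config) λ cs →
      Unique cs × (∀ {c} → c ∈ cs → c ∈ configs) × (∀ i {c} → c ∈ cs → Fits (decode d i) c (f i)) ×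
      length configs * fitRate ^ (b ^ d) ≤ length cs * length (codePairs n) ^ (b ^ d)
    fitting-configs = pigeonholes (b ^ d) (λ i c → fits? (decode d i) c) fitRate
      (codePairs n) (idCode n , idCode n) (λ i c _ → count-fits (decode d i) c) configs-unique

    many-transversals : ∃ λ m → TAtLeast d N m ×
      length (words q s) ^ b * (n !) ^ (b * d) * fitRate ^ (b ^ d) ≤ m * (n ! * n !) ^ (b ^ d)
    many-transversals = let f , cs , cs-unique , _ , fits , le = fitting-configs in
      length cs , fitting-transversals f cs cs-unique fits , (begin
        length (words q s) ^ b * (n !) ^ (b * d) * fitRate ^ (b ^ d) ≡⟨ cong (_* fitRate ^ (b ^ d)) length-configs ⟨
        length configs * fitRate ^ (b ^ d)                           ≤⟨ le ⟩
        length cs * length (codePairs n) ^ (b ^ d)                   ≡⟨ cong (λ l → length cs * l ^ (b ^ d)) (length-codePairs n) ⟩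
        length cs * (n ! * n !) ^ (b ^ d) ∎)
      where open ≤-Reasoning

-- Elementary estimates for factorials and powers

module Estimates where

  open import Data.Nat using (zero; suc; _+_; _*_; _^_; _∸_; _≤_; z≤n; _!; NonZero)
  open import Data.Nat.Properties
  open import Data.Nat.Tactic.RingSolver using (solve-∀)
  open import Relation.Binary.PropositionalEquality

  ^-distribʳ-* : ∀ m n k → (m * n) ^ k ≡ m ^ k * n ^ k
  ^-distribʳ-* m n zero = refl
  ^-distribʳ-* m n (suc k) = trans (cong (m * n *_) (^-distribʳ-* m n k)) (regroup m n (m ^ k) (n ^ k))
    where
    regroup : ∀ m n x y → m * n * (x * y) ≡ m * x * (n * y)
    regroup = solve-∀

  !-≤-^*! : ∀ n s → s ≤ n → n ! ≤ n ^ s * (n ∸ s) !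
  !-≤-^*! n zero _ = ≤-reflexive (sym (+-identityʳ (n !)))
  !-≤-^*! n (suc s) s<n = begin
    n !                                     ≤⟨ !-≤-^*! n s (<⇒≤ s<n) ⟩
    n ^ s * (n ∸ s) !                       ≡⟨ cong (λ m → n ^ s * m !) (+-∸-assoc 1 s<n) ⟩
    n ^ s * (suc (n ∸ suc s) * (n ∸ suc s) !) ≤⟨ *-monoʳ-≤ (n ^ s) (*-monoˡ-≤ ((n ∸ suc s) !)
                                                  (≤-trans (≤-reflexive (sym (+-∸-assoc 1 s<n))) (m∸n≤m n s))) ⟩
    n ^ s * (n * (n ∸ suc s) !)             ≡⟨ regroup (n ^ s) n ((n ∸ suc s) !) ⟩
    n * n ^ s * (n ∸ suc s) ! ∎
    where
    open ≤-Reasoning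
    regroup : ∀ x n y → x * (n * y) ≡ n * x * y
    regroup = solve-∀

  !*^-≤-! : ∀ n k → n ! * n ^ k ≤ (k + n) !
  !*^-≤-! n zero = ≤-reflexive (*-identityʳ (n !))
  !*^-≤-! n (suc k) = begin
    n ! * (n * n ^ k)      ≡⟨ regroup (n !) n (n ^ k) ⟩
    n * (n ! * n ^ k)      ≤⟨ *-mono-≤ (m≤n+m n (suc k)) (!*^-≤-! n k) ⟩
    (suc k + n) * (k + n) ! ∎
    where
    open ≤-Reasoning
    regroup : ∀ x n y → x * (n * y) ≡ n * (x * y)
    regroup = solve-∀

  !-≤-!*^ : ∀ n k → (k + n) ! ≤ n ! * (k + n) ^ k
  !-≤-!*^ n zero = ≤-reflexive (sym (*-identityʳ (n !)))
  !-≤-!*^ n (suc k) = begin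
    (suc k + n) * (k + n) !              ≤⟨ *-monoʳ-≤ (suc k + n) (!-≤-!*^ n k) ⟩
    (suc k + n) * (n ! * (k + n) ^ k)    ≤⟨ *-monoʳ-≤ (suc k + n) (*-monoʳ-≤ (n !) (^-monoˡ-≤ k (n≤1+n (k + n)))) ⟩
    (suc k + n) * (n ! * (suc k + n) ^ k) ≡⟨ regroup (n !) (suc k + n) ((suc k + n) ^ k) ⟩
    n ! * ((suc k + n) * (suc k + n) ^ k) ∎
    where
    open ≤-Reasoning
    regroup : ∀ x n y → n * (x * y) ≡ x * (n * y)
    regroup = solve-∀

  -- A multinomial coefficient with k parts is at most the number of all words over k letters. The
  -- induction enlarges all parts at once: the k new factors of the factorial are each at most k (n
  -- + 1).
  !-*-≤ : ∀ k n → (k * n) ! ≤ k ^ (k * n) * (n !) ^ k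
  !-*-≤ k zero rewrite *-zeroʳ k | ^-zeroˡ k = ≤-refl
  !-*-≤ k (suc n) = begin
    (k * suc n) !                                ≡⟨ cong _! (*-suc k n) ⟩
    (k + k * n) !                                ≤⟨ !-≤-!*^ (k * n) k ⟩
    (k * n) ! * (k + k * n) ^ k                  ≤⟨ *-monoˡ-≤ ((k + k * n) ^ k) (!-*-≤ k n) ⟩
    k ^ (k * n) * (n !) ^ k * (k + k * n) ^ k    ≡⟨ cong (k ^ (k * n) * (n !) ^ k *_)
                                                      (trans (cong (_^ k) (sym (*-suc k n))) (^-distribʳ-* k (suc n) k)) ⟩
    k ^ (k * n) * (n !) ^ k * (k ^ k * suc n ^ k) ≡⟨ regroup (k ^ (k * n)) ((n !) ^ k) (k ^ k) (suc n ^ k) ⟩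
    k ^ k * k ^ (k * n) * (suc n ^ k * (n !) ^ k) ≡⟨ cong₂ _*_ (trans (sym (^-distribˡ-+-* k k (k * n))) (cong (k ^_) (sym (*-suc k n))))
                                                      (sym (^-distribʳ-* (suc n) (n !) k)) ⟩
    k ^ (k * suc n) * (suc n !) ^ k ∎
    where
    open ≤-Reasoning
    regroup : ∀ a b c d → a * b * (c * d) ≡ c * a * (d * b)
    regroup = solve-∀

  multinomial-step : ∀ q s → q ^ (q * s) * (s !) ^ q ≤ (q * suc s) ! →
    q ^ (q * suc s) * (suc s !) ^ q ≤ (q * suc s) ! * (q * suc s) ^ q
  multinomial-step q s h = begin
    q ^ (q * suc s) * (suc s * s !) ^ q
      ≡⟨ cong₂ _*_ (trans (cong (q ^_) (*-suc q s)) (^-distribˡ-+-* q q (q * s))) (^-distribʳ-* (suc s) (s !) q) ⟩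
    q ^ q * q ^ (q * s) * (suc s ^ q * (s !) ^ q)
      ≡⟨ regroup (q ^ q) (q ^ (q * s)) (suc s ^ q) ((s !) ^ q) ⟩
    q ^ (q * s) * (s !) ^ q * (q ^ q * suc s ^ q)
      ≤⟨ *-monoˡ-≤ (q ^ q * suc s ^ q) h ⟩
    (q * suc s) ! * (q ^ q * suc s ^ q)
      ≡⟨ cong ((q * suc s) ! *_) (^-distribʳ-* q (suc s) q) ⟨
    (q * suc s) ! * (q * suc s) ^ q ∎
    where
    open ≤-Reasoning
    regroup : ∀ a b c d → a * b * (c * d) ≡ b * d * (a * c)
    regroup = solve-∀

  -- The factorial on the right is one step ahead on purpose. Each step multiplies the left side by
  -- (q (s + 1))^q, which is too much for the factors between (q s)! and (q (s + 1))!, but fits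
  -- below those of the next stretch.
  ^*!^-≤-! : ∀ q s → q ^ (q * s) * (s !) ^ q ≤ (q * suc s) !
  ^*!^-≤-! q zero rewrite *-zeroʳ q | ^-zeroˡ q = 1≤n! (q * 1)
  ^*!^-≤-! q (suc s) = ≤-trans (multinomial-step q s (^*!^-≤-! q s))
    (≤-trans (!*^-≤-! (q * suc s) q) (≤-reflexive (cong _! (sym (*-suc q (suc s))))))

  -- The price of demanding exactly s points per block: balanced words are at least a fraction (q
  -- s)^(-q) of all words, a loss of one factor n = q s for each letter.
  multinomial-≥ : ∀ q s .{{_ : NonZero s}} → q ^ (q * s) * (s !) ^ q ≤ (q * s) ! * (q * s) ^ q
  multinomial-≥ q (suc s) = multinomial-step q s (^*!^-≤-! q s)

  n≤2^n : ∀ n → n ≤ 2 ^ n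
  n≤2^n zero = z≤n
  n≤2^n (suc n) = ≤-trans (+-mono-≤ (m^n>0 2 n) (n≤2^n n)) (≤-reflexive (cong (2 ^ n +_) (sym (+-identityʳ (2 ^ n)))))

  *4*-≤-2^ : ∀ c .{{_ : NonZero c}} → c * (4 * c) ≤ 2 ^ (4 * c)
  *4*-≤-2^ (suc c′) = begin
    c * (4 * c)                     ≡⟨ regroup c ⟩
    4 * (c * c)                     ≤⟨ *-mono-≤ (^-monoʳ-≤ 2 {2} {c + c} (≤-trans (m≤m+n 2 (c′ + c′)) (≤-reflexive (cong suc (sym (+-suc c′ c′))))))
                                                (*-mono-≤ (n≤2^n c) (n≤2^n c)) ⟩
    2 ^ (c + c) * (2 ^ c * 2 ^ c)   ≡⟨ cong (2 ^ (c + c) *_) (^-distribˡ-+-* 2 c c) ⟨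
    2 ^ (c + c) * 2 ^ (c + c)       ≡⟨ ^-distribˡ-+-* 2 (c + c) (c + c) ⟨
    2 ^ (c + c + (c + c))           ≡⟨ cong (2 ^_) (regroup′ c) ⟩
    2 ^ (4 * c) ∎
    where
    open ≤-Reasoning
    c = suc c′
    regroup : ∀ c → c * (4 * c) ≡ 4 * (c * c)
    regroup = solve-∀
    regroup′ : ∀ c → c + c + (c + c) ≡ 4 * c
    regroup′ = solve-∀

  -- The first two terms of the binomial expansion. For `r = suc j` they are equal, which gives (1 +
  -- 1/r)^r ≥ 2.
  bernoulli : ∀ r j → r ^ suc j + suc j * r ^ j ≤ suc r ^ suc j
  bernoulli r zero = ≤-reflexive (regroup r)
    where
    regroup : ∀ r → r * 1 + 1 * 1 ≡ suc r * 1
    regroup = solve-∀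
  bernoulli r (suc j) = begin
    r ^ suc (suc j) + suc (suc j) * r ^ suc j  ≡⟨ regroup r j (r ^ j) ⟩
    r ^ suc j + r * (r ^ suc j + suc j * r ^ j)
      ≤⟨ +-mono-≤ (≤-trans (m≤m+n (r ^ suc j) (suc j * r ^ j)) (bernoulli r j)) (*-monoʳ-≤ r (bernoulli r j)) ⟩
    suc r ^ suc (suc j) ∎
    where
    open ≤-Reasoning
    regroup : ∀ r j x → r * (r * x) + suc (suc j) * (r * x) ≡ r * x + r * (r * x + suc j * x)
    regroup = solve-∀

  2*^-≤-^ : ∀ r .{{_ : NonZero r}} → 2 * r ^ r ≤ suc r ^ r
  2*^-≤-^ r@(suc j) = ≤-trans (≤-reflexive (cong (r ^ r +_) (+-identityʳ (r ^ r)))) (bernoulli r j)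

  2^*^-≤-^ : ∀ r t .{{_ : NonZero r}} → 2 ^ t * r ^ (r * t) ≤ suc r ^ (r * t)
  2^*^-≤-^ r t = begin
    2 ^ t * r ^ (r * t)     ≡⟨ cong (2 ^ t *_) (^-*-assoc r r t) ⟨
    2 ^ t * (r ^ r) ^ t     ≡⟨ ^-distribʳ-* 2 (r ^ r) t ⟨
    (2 * r ^ r) ^ t         ≤⟨ ^-monoˡ-≤ t (2*^-≤-^ r) ⟩
    (suc r ^ r) ^ t         ≡⟨ ^-*-assoc (suc r) r t ⟩
    suc r ^ (r * t) ∎
    where open ≤-Reasoning

  -- For r = 2(k+1) and q = 4(k+1) + g this is  (k/(k+1)) (1 + 1/r) ≤ 1 - 2/q.
  rate-≤ : ∀ k g → let r = 2 * suc k ; e = 2 + 4 * k + g in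
    suc r * (k * (2 + e)) ≤ r * (suc k * e)
  rate-≤ k g = m+n≤o⇒m≤o _ (≤-reflexive (identity k g))
    where
    identity : ∀ k g → suc (2 * suc k) * (k * (2 + (2 + 4 * k + g))) + (4 + 4 * k + g * (2 + k))
      ≡ 2 * suc k * (suc k * (2 + 4 * k + g))
    identity = solve-∀

  -- The lone factor n is the loss per block in `multinomial-≥`. Because of (1 + 1/r)^r ≥ 2 it is at
  -- most 2^t ≤ (1 + 1/r)^s, so it can be spread over the s points of the block, where `rate-≤`
  -- absorbs it.
  rate-^-≤ : ∀ k g t → let r = 2 * suc k ; e = 2 + 4 * k + g ; q = 2 + e ; s = r * t ; n = q * s in
    n ≤ 2 ^ t → (k * n) ^ s * n ≤ (suc k * (n ∸ (s + s))) ^ s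
  rate-^-≤ k g t n≤2^t = begin
    (k * n) ^ s * n                       ≡⟨ cong (_* n) (trans (cong (_^ s) (sym (*-assoc k q s))) (^-distribʳ-* (k * q) s s)) ⟩
    (k * q) ^ s * s ^ s * n               ≡⟨ regroup ((k * q) ^ s) (s ^ s) n ⟩
    n * (k * q) ^ s * s ^ s               ≤⟨ *-monoˡ-≤ (s ^ s) (*-cancelˡ-≤ (r ^ s) {{m^n≢0 r s}} scaled) ⟩
    (suc k * e) ^ s * s ^ s               ≡⟨ trans (sym (^-distribʳ-* (suc k * e) s s)) (cong (_^ s) (*-assoc (suc k) e s)) ⟩
    (suc k * (e * s)) ^ s                 ≡⟨ cong (λ x → (suc k * x) ^ s) (trans (sym (m+n∸m≡n (s + s) (e * s))) (cong (_∸ (s + s)) (+-assoc s s (e * s)))) ⟩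
    (suc k * (n ∸ (s + s))) ^ s ∎
    where
    open ≤-Reasoning
    r = 2 * suc k
    e = 2 + 4 * k + g
    q = 2 + e
    s = r * t
    n = q * s
    regroup : ∀ a b c → a * b * c ≡ c * a * b
    regroup = solve-∀
    scaled : r ^ s * (n * (k * q) ^ s) ≤ r ^ s * (suc k * e) ^ s
    scaled = begin
      r ^ s * (n * (k * q) ^ s)           ≡⟨ regroup′ (r ^ s) n ((k * q) ^ s) ⟩
      n * r ^ s * (k * q) ^ s             ≤⟨ *-monoˡ-≤ ((k * q) ^ s) (≤-trans (*-monoˡ-≤ (r ^ s) n≤2^t) (2^*^-≤-^ r t)) ⟩
      suc r ^ s * (k * q) ^ s             ≡⟨ ^-distribʳ-* (suc r) (k * q) s ⟨
      (suc r * (k * q)) ^ s               ≤⟨ ^-monoˡ-≤ s (rate-≤ k g) ⟩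
      (r * (suc k * e)) ^ s               ≡⟨ ^-distribʳ-* r (suc k * e) s ⟩
      r ^ s * (suc k * e) ^ s ∎
      where
      regroup′ : ∀ a b c → a * (b * c) ≡ b * a * c
      regroup′ = solve-∀

-- The lower bound in natural numbers

module Bound where

  open Estimates
  open import Data.Nat using (ℕ; suc; _+_; _*_; _^_; _∸_; _≤_; _!; NonZero)
  open import Data.Nat.Properties
  open import Data.Nat.Tactic.RingSolver using (solve-∀)
  open import Relation.Binary.PropositionalEquality

  -- `W` stands for the number of words and `m` for the number of transversals; both are known only
  -- through the hypotheses of the lemmas.
  module _ (k b d′ s W m : ℕ) where

    private
      d = suc d′
      q = b ^ d′
      n = q * s
      N = b * n
      u = n ∸ (s + s)
      f = (n ∸ s) !

    ^-block : ∀ x → (x ^ s) ^ (b ^ d) ≡ x ^ N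
    ^-block x = trans (^-*-assoc x s (b ^ d)) (cong (x ^_) (regroup s b q))
      where
      regroup : ∀ s b q → s * (b * q) ≡ b * (q * s)
      regroup = solve-∀

    -- Since n! ≤ n^s (n - s)!, the factor ((n - s)!)^2 of every block cancels, and the fitting
    -- proportion becomes (u / n^2)^N.
    cancel-fit : s ≤ n →
      W ^ b * (n !) ^ (b * d) * (u ^ s * (f * f)) ^ (b ^ d) ≤ m * (n ! * n !) ^ (b ^ d) →
      W ^ b * (n !) ^ (b * d) * u ^ N ≤ m * (n ^ N * n ^ N)
    cancel-fit s≤n h = *-cancelʳ-≤ _ _ ((f * f) ^ (b ^ d))
      {{m^n≢0 (f * f) (b ^ d) {{(n ∸ s) !* (n ∸ s) !≢0}}}} (begin
      W ^ b * (n !) ^ (b * d) * u ^ N * (f * f) ^ (b ^ d)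
        ≡⟨ *-assoc (W ^ b * (n !) ^ (b * d)) (u ^ N) _ ⟩
      W ^ b * (n !) ^ (b * d) * (u ^ N * (f * f) ^ (b ^ d))
        ≡⟨ cong (W ^ b * (n !) ^ (b * d) *_) (trans (^-distribʳ-* (u ^ s) (f * f) (b ^ d)) (cong (_* (f * f) ^ (b ^ d)) (^-block u))) ⟨
      W ^ b * (n !) ^ (b * d) * (u ^ s * (f * f)) ^ (b ^ d)
        ≤⟨ h ⟩
      m * (n ! * n !) ^ (b ^ d)
        ≤⟨ *-monoʳ-≤ m (^-monoˡ-≤ (b ^ d) (*-mono-≤ (!-≤-^*! n s s≤n) (!-≤-^*! n s s≤n))) ⟩
      m * (n ^ s * f * (n ^ s * f)) ^ (b ^ d)
        ≡⟨ cong (λ x → m * x ^ (b ^ d)) (regroup (n ^ s) f) ⟩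
      m * (n ^ s * n ^ s * (f * f)) ^ (b ^ d)
        ≡⟨ cong (m *_) (trans (^-distribʳ-* (n ^ s * n ^ s) (f * f) (b ^ d)) (cong (_* (f * f) ^ (b ^ d))
             (trans (^-distribʳ-* (n ^ s) (n ^ s) (b ^ d)) (cong₂ _*_ (^-block n) (^-block n))))) ⟩
      m * (n ^ N * n ^ N * (f * f) ^ (b ^ d))
        ≡⟨ *-assoc m (n ^ N * n ^ N) _ ⟨
      m * (n ^ N * n ^ N) * (f * f) ^ (b ^ d) ∎)
      where
      open ≤-Reasoning
      regroup : ∀ x f → x * f * (x * f) ≡ x * x * (f * f)
      regroup = solve-∀

    words-≥ : .{{_ : NonZero s}} → W * (s !) ^ q ≡ n ! → q ^ N ≤ W ^ b * (n ^ q) ^ b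
    words-≥ hW = begin
      q ^ N               ≡⟨ trans (cong (q ^_) (*-comm b n)) (sym (^-*-assoc q n b)) ⟩
      (q ^ n) ^ b         ≤⟨ ^-monoˡ-≤ b (*-cancelʳ-≤ _ _ ((s !) ^ q) {{m^n≢0 (s !) q {{s !≢0}}}} scaled) ⟩
      (W * n ^ q) ^ b     ≡⟨ ^-distribʳ-* W (n ^ q) b ⟩
      W ^ b * (n ^ q) ^ b ∎
      where
      open ≤-Reasoning
      regroup : ∀ a b c → a * b * c ≡ a * c * b
      regroup = solve-∀
      scaled : q ^ n * (s !) ^ q ≤ W * n ^ q * (s !) ^ q
      scaled = begin
        q ^ n * (s !) ^ q     ≤⟨ multinomial-≥ q s ⟩
        n ! * n ^ q           ≡⟨ cong (_* n ^ q) hW ⟨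
        W * (s !) ^ q * n ^ q ≡⟨ regroup W ((s !) ^ q) (n ^ q) ⟩
        W * n ^ q * (s !) ^ q ∎

    -- `(n ^ q) ^ b` is one factor n for each of the b^d blocks, the same loss as in `words-≥`; one
    -- copy of the hypothesis per block pays for it.
    rate-N : (k * n) ^ s * n ≤ (suc k * u) ^ s → k ^ N * n ^ N * (n ^ q) ^ b ≤ suc k ^ N * u ^ N
    rate-N h = begin
      k ^ N * n ^ N * (n ^ q) ^ b     ≡⟨ cong₂ _*_ (trans (sym (^-distribʳ-* k n N)) (sym (^-block (k * n))))
                                            (trans (^-*-assoc n q b) (cong (n ^_) (*-comm q b))) ⟩
      ((k * n) ^ s) ^ (b ^ d) * n ^ (b ^ d) ≡⟨ ^-distribʳ-* ((k * n) ^ s) n (b ^ d) ⟨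
      ((k * n) ^ s * n) ^ (b ^ d)     ≤⟨ ^-monoˡ-≤ (b ^ d) h ⟩
      ((suc k * u) ^ s) ^ (b ^ d)     ≡⟨ trans (^-block (suc k * u)) (^-distribʳ-* (suc k) u N) ⟩
      suc k ^ N * u ^ N ∎
      where open ≤-Reasoning

    factorial-≤ : (d * N) ! ≤ (d * b) ^ (d * N) * (n !) ^ (b * d)
    factorial-≤ = subst₂ (λ x y → x ! ≤ (d * b) ^ x * (n !) ^ y) (*-assoc d b n) (*-comm d b) (!-*-≤ (d * b) n)

    N^d′ : (N ^ d′) ^ N ≡ q ^ N * (n ^ d′) ^ N
    N^d′ = trans (cong (_^ N) (^-distribʳ-* b n d′)) (^-distribʳ-* q (n ^ d′) N)

    [n^d′]^N*n^N : (n ^ d′) ^ N * n ^ N ≡ n ^ (d * N)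
    [n^d′]^N*n^N = trans (sym (^-distribʳ-* (n ^ d′) n N)) (trans (cong (_^ N) (*-comm (n ^ d′) n)) (^-*-assoc n d N))

    -- With the denominators cleared, this bounds m times the series term (dN)^(dN) / (dN)! from
    -- below by ((k / (k + 1)) N^(d-1))^N.
    transversals-≥ : .{{_ : NonZero s}} .{{_ : NonZero n}} → s ≤ n → W * (s !) ^ q ≡ n ! →
      W ^ b * (n !) ^ (b * d) * (u ^ s * (f * f)) ^ (b ^ d) ≤ m * (n ! * n !) ^ (b ^ d) →
      (k * n) ^ s * n ≤ (suc k * u) ^ s →
      k ^ N * (N ^ d′) ^ N * (d * N) ! ≤ m * (d * N) ^ (d * N) * suc k ^ N
    transversals-≥ s≤n hW hC hr = *-cancelʳ-≤ _ _ (Z * Y)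
      {{m*n≢0 Z Y {{m*n≢0 (n ^ N) (n ^ N) {{m^n≢0 n N}} {{m^n≢0 n N}}}} {{m^n≢0 (n ^ q) b {{m^n≢0 n q}}}}}} (begin
      k ^ N * (N ^ d′) ^ N * (d * N) ! * (Z * Y)
        ≡⟨ cong (λ x → k ^ N * x * (d * N) ! * (Z * Y)) N^d′ ⟩
      k ^ N * (q ^ N * G) * (d * N) ! * (n ^ N * n ^ N * Y)
        ≡⟨ regroup₁ (k ^ N) (q ^ N) G ((d * N) !) (n ^ N) Y ⟩
      k ^ N * n ^ N * Y * (q ^ N * (G * n ^ N) * (d * N) !)
        ≡⟨ cong (λ x → k ^ N * n ^ N * Y * (q ^ N * x * (d * N) !)) [n^d′]^N*n^N ⟩
      k ^ N * n ^ N * Y * (q ^ N * n ^ (d * N) * (d * N) !)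
        ≤⟨ *-mono-≤ (rate-N hr) (*-mono-≤ (*-monoˡ-≤ (n ^ (d * N)) (words-≥ hW)) factorial-≤) ⟩
      suc k ^ N * u ^ N * (W ^ b * Y * n ^ (d * N) * ((d * b) ^ (d * N) * F))
        ≡⟨ regroup₂ (suc k ^ N) (u ^ N) (W ^ b) Y (n ^ (d * N)) ((d * b) ^ (d * N)) F ⟩
      W ^ b * F * u ^ N * (suc k ^ N * Y * ((d * b) ^ (d * N) * n ^ (d * N)))
        ≡⟨ cong (λ x → W ^ b * F * u ^ N * (suc k ^ N * Y * x))
             (trans (sym (^-distribʳ-* (d * b) n (d * N))) (cong (_^ (d * N)) (*-assoc d b n))) ⟩
      W ^ b * F * u ^ N * (suc k ^ N * Y * (d * N) ^ (d * N))
        ≤⟨ *-monoˡ-≤ (suc k ^ N * Y * (d * N) ^ (d * N)) (cancel-fit s≤n hC) ⟩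
      m * Z * (suc k ^ N * Y * (d * N) ^ (d * N))
        ≡⟨ regroup₃ m Z (suc k ^ N) Y ((d * N) ^ (d * N)) ⟩
      m * (d * N) ^ (d * N) * suc k ^ N * (Z * Y) ∎)
      where
      open ≤-Reasoning
      -- `Z` is the denominator of the fitting proportion and `Y` the loss in `words-≥` that
      -- `rate-N` repays; their product is the common factor cancelled at the end.
      Y = (n ^ q) ^ b
      Z = n ^ N * n ^ N
      G = (n ^ d′) ^ N
      F = (n !) ^ (b * d)
      regroup₁ : ∀ k q g e x y → k * (q * g) * e * (x * x * y) ≡ k * x * y * (q * (g * x) * e)
      regroup₁ = solve-∀
      regroup₂ : ∀ k u w y x e f → k * u * (w * y * x * (e * f)) ≡ w * f * u * (k * y * (e * x))
      regroup₂ = solve-∀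
      regroup₃ : ∀ m z k y x → m * z * (k * y * x) ≡ m * x * k * (z * y)
      regroup₃ = solve-∀

-- Passage to rationals and to the exponential series

module Rationals where

  open import Defs
  open Estimates using (^-distribʳ-*)
  open import Data.Nat as ℕ using (ℕ; zero; suc; _!)
  open import Data.Nat.Properties as ℕₚ using (_!≢0)
  open import Data.Nat.Coprimality using (1-coprimeTo)
  open import Data.Integer as ℤ using (+_; +≤+)
  import Data.Integer.Properties as ℤₚ
  open import Data.Rational as ℚ using (ℚ; mkℚ; _/_; _*_; _+_; _-_; 0ℚ; 1ℚ; toℚᵘ; NonNegative; Positive)
  open import Data.Rational.Properties
  open import Data.Rational.Unnormalised as ℚᵘ using (mkℚᵘ; *≡*; _≃_)
  import Data.Rational.Unnormalised.Properties as ℚᵘₚ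
  open import Data.Product using (_,_)
  open import Algebra.Bundles using (CommutativeMonoid)
  open import Algebra.Properties.CommutativeSemigroup (CommutativeMonoid.commutativeSemigroup *-1-commutativeMonoid) using (interchange; xy∙z≈xz∙y)
  open import Relation.Binary.PropositionalEquality

  toℚᵘ-fromℕ : ∀ n → toℚᵘ (fromℕ n) ≃ mkℚᵘ (+ n) 0
  toℚᵘ-fromℕ n = toℚᵘ-fromℚᵘ (mkℚᵘ (+ n) 0)

  fromℕ-* : ∀ m n → fromℕ (m ℕ.* n) ≡ fromℕ m * fromℕ n
  fromℕ-* m n = toℚᵘ-injective (begin-equality
    toℚᵘ (fromℕ (m ℕ.* n))               ≃⟨ toℚᵘ-fromℕ (m ℕ.* n) ⟩
    mkℚᵘ (+ (m ℕ.* n)) 0                 ≃⟨ *≡* (cong (ℤ._* + 1) (ℤₚ.pos-* m n)) ⟩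
    mkℚᵘ (+ m) 0 ℚᵘ.* mkℚᵘ (+ n) 0       ≃⟨ ℚᵘₚ.*-cong (toℚᵘ-fromℕ m) (toℚᵘ-fromℕ n) ⟨
    toℚᵘ (fromℕ m) ℚᵘ.* toℚᵘ (fromℕ n)   ≃⟨ toℚᵘ-homo-* (fromℕ m) (fromℕ n) ⟨
    toℚᵘ (fromℕ m * fromℕ n) ∎)
    where open ℚᵘₚ.≤-Reasoning

  fromℕ-mono-≤ : ∀ {m n} → m ℕ.≤ n → fromℕ m ℚ.≤ fromℕ n
  fromℕ-mono-≤ {m} {n} m≤n = toℚᵘ-cancel-≤ (begin
    toℚᵘ (fromℕ m)  ≃⟨ toℚᵘ-fromℕ m ⟩
    mkℚᵘ (+ m) 0    ≤⟨ ℚᵘ.*≤* (ℤₚ.*-monoʳ-≤-nonNeg (+ 1) (+≤+ m≤n)) ⟩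
    mkℚᵘ (+ n) 0    ≃⟨ toℚᵘ-fromℕ n ⟨
    toℚᵘ (fromℕ n) ∎)
    where open ℚᵘₚ.≤-Reasoning

  ^ℚ-distribʳ-* : ∀ x y n → (x * y) ^ℚ n ≡ x ^ℚ n * y ^ℚ n
  ^ℚ-distribʳ-* x y zero = refl
  ^ℚ-distribʳ-* x y (suc n) = trans (cong (x * y *_) (^ℚ-distribʳ-* x y n)) (interchange x y (x ^ℚ n) (y ^ℚ n))

  fromℕ-^ : ∀ m n → fromℕ (m ℕ.^ n) ≡ fromℕ m ^ℚ n
  fromℕ-^ m zero = refl
  fromℕ-^ m (suc n) = trans (fromℕ-* m (m ℕ.^ n)) (cong (fromℕ m *_) (fromℕ-^ m n))

  unitFraction : ∀ n .{{_ : ℕ.NonZero n}} → ℚ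
  unitFraction n = + 1 / n

  unitFraction-* : ∀ n .{{_ : ℕ.NonZero n}} → unitFraction n * fromℕ n ≡ 1ℚ
  unitFraction-* (suc n) = toℚᵘ-injective (begin-equality
    toℚᵘ (+ 1 / suc n * fromℕ (suc n))                   ≃⟨ toℚᵘ-homo-* (+ 1 / suc n) (fromℕ (suc n)) ⟩
    toℚᵘ (+ 1 / suc n) ℚᵘ.* toℚᵘ (fromℕ (suc n))         ≃⟨ ℚᵘₚ.*-cong (toℚᵘ-fromℚᵘ (mkℚᵘ (+ 1) n)) (toℚᵘ-fromℕ (suc n)) ⟩
    mkℚᵘ (+ 1) n ℚᵘ.* mkℚᵘ (+ suc n) 0                   ≃⟨ *≡* (cong +_ (cong suc (trans (ℕₚ.*-identityʳ (n ℕ.+ 0)) (cong (ℕ._+ 0) (sym (ℕₚ.*-identityʳ n)))))) ⟩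
    toℚᵘ 1ℚ ∎)
    where open ℚᵘₚ.≤-Reasoning

  unitFraction-nonNeg : ∀ n .{{_ : ℕ.NonZero n}} → NonNegative (unitFraction n)
  unitFraction-nonNeg n = normalize-nonNeg 1 n

  fromℕ-nonNeg : ∀ n → NonNegative (fromℕ n)
  fromℕ-nonNeg n = normalize-nonNeg n 1

  fromℕ-pos : ∀ n .{{_ : ℕ.NonZero n}} → Positive (fromℕ n)
  fromℕ-pos n = normalize-pos n 1

  expTerm : ℕ → ℕ → ℚ
  expTerm a j = fromℕ a ^ℚ j * unitFraction (j !) {{j !≢0}}

  expTerm-nonNeg : ∀ a j → NonNegative (expTerm a j)
  expTerm-nonNeg a j = subst (λ x → NonNegative (x * unitFraction (j !) {{j !≢0}})) (fromℕ-^ a j)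
    (nonNeg*nonNeg⇒nonNeg (fromℕ (a ℕ.^ j)) {{fromℕ-nonNeg (a ℕ.^ j)}} (unitFraction (j !) {{j !≢0}}) {{unitFraction-nonNeg (j !) {{j !≢0}}}})

  expPartial-nonNeg : ∀ a j → 0ℚ ℚ.≤ expPartial (fromℕ a) j
  expPartial-nonNeg a zero = ≤-refl
  expPartial-nonNeg a (suc j) = +-mono-≤ (expPartial-nonNeg a j) (nonNegative⁻¹ (expTerm a j) {{expTerm-nonNeg a j}})

  expTerm-≤ : ∀ a j → expTerm a j ℚ.≤ expPartial (fromℕ a) (suc j)
  expTerm-≤ a j = ≤-trans (≤-reflexive (sym (+-identityˡ (expTerm a j)))) (+-monoˡ-≤ (expTerm a j) (expPartial-nonNeg a j))

  expTerm-* : ∀ a j → expTerm a j * fromℕ (j !) ≡ fromℕ (a ℕ.^ j)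
  expTerm-* a j = begin
    fromℕ a ^ℚ j * w * fromℕ (j !)    ≡⟨ *-assoc (fromℕ a ^ℚ j) w (fromℕ (j !)) ⟩
    fromℕ a ^ℚ j * (w * fromℕ (j !))  ≡⟨ cong (fromℕ a ^ℚ j *_) (unitFraction-* (j !) {{j !≢0}}) ⟩
    fromℕ a ^ℚ j * 1ℚ                 ≡⟨ *-identityʳ (fromℕ a ^ℚ j) ⟩
    fromℕ a ^ℚ j                      ≡⟨ fromℕ-^ a j ⟨
    fromℕ (a ℕ.^ j) ∎
    where
    open ≡-Reasoning
    w = unitFraction (j !) {{j !≢0}}

  -- Only the term i = dN of the exponential series is used.
  atLeastOverExpPow : ∀ k B m d N (x : ℚ) → x * fromℕ (suc k) ≡ fromℕ k →
    k ℕ.^ N ℕ.* B ℕ.^ N ℕ.* (d ℕ.* N) ! ℕ.≤ m ℕ.* (d ℕ.* N) ℕ.^ (d ℕ.* N) ℕ.* suc k ℕ.^ N →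
    AtLeastOverExpPow m (x * fromℕ B) d N
  atLeastOverExpPow k B m d N x eq le = suc M , ≤-trans
    (*-cancelʳ-≤-pos (K * fromℕ (M !)) {{pos*pos⇒pos K {{K-pos}} (fromℕ (M !)) {{fromℕ-pos (M !) {{M !≢0}}}}}} scaled)
    (*-monoˡ-≤-nonNeg (fromℕ m) {{fromℕ-nonNeg m}} (expTerm-≤ M M))
    where
    M = d ℕ.* N
    K = fromℕ (suc k) ^ℚ N
    K-pos : Positive K
    K-pos = subst Positive (fromℕ-^ (suc k) N) (fromℕ-pos (suc k ℕ.^ N) {{ℕₚ.m^n≢0 (suc k) N}})
    scaled : (x * fromℕ B) ^ℚ N * (K * fromℕ (M !)) ℚ.≤ fromℕ m * expTerm M M * (K * fromℕ (M !))
    scaled = begin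
      (x * fromℕ B) ^ℚ N * (K * fromℕ (M !))       ≡⟨ *-assoc ((x * fromℕ B) ^ℚ N) K (fromℕ (M !)) ⟨
      (x * fromℕ B) ^ℚ N * K * fromℕ (M !)         ≡⟨ cong (_* fromℕ (M !)) (^ℚ-distribʳ-* (x * fromℕ B) (fromℕ (suc k)) N) ⟨
      (x * fromℕ B * fromℕ (suc k)) ^ℚ N * fromℕ (M !)
        ≡⟨ cong (λ y → y ^ℚ N * fromℕ (M !)) (trans (xy∙z≈xz∙y x (fromℕ B) (fromℕ (suc k))) (cong (_* fromℕ B) eq)) ⟩
      (fromℕ k * fromℕ B) ^ℚ N * fromℕ (M !)       ≡⟨ cong (λ y → y ^ℚ N * fromℕ (M !)) (fromℕ-* k B) ⟨
      fromℕ (k ℕ.* B) ^ℚ N * fromℕ (M !)           ≡⟨ cong (_* fromℕ (M !)) (fromℕ-^ (k ℕ.* B) N) ⟨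
      fromℕ ((k ℕ.* B) ℕ.^ N) * fromℕ (M !)        ≡⟨ fromℕ-* ((k ℕ.* B) ℕ.^ N) (M !) ⟨
      fromℕ ((k ℕ.* B) ℕ.^ N ℕ.* M !)              ≡⟨ cong (λ y → fromℕ (y ℕ.* M !)) (^-distribʳ-* k B N) ⟩
      fromℕ (k ℕ.^ N ℕ.* B ℕ.^ N ℕ.* M !)          ≤⟨ fromℕ-mono-≤ le ⟩
      fromℕ (m ℕ.* M ℕ.^ M ℕ.* suc k ℕ.^ N)        ≡⟨ fromℕ-* (m ℕ.* M ℕ.^ M) (suc k ℕ.^ N) ⟩
      fromℕ (m ℕ.* M ℕ.^ M) * fromℕ (suc k ℕ.^ N)  ≡⟨ cong₂ _*_ (fromℕ-* m (M ℕ.^ M)) (fromℕ-^ (suc k) N) ⟩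
      fromℕ m * fromℕ (M ℕ.^ M) * K                ≡⟨ cong (λ y → fromℕ m * y * K) (expTerm-* M M) ⟨
      fromℕ m * (expTerm M M * fromℕ (M !)) * K    ≡⟨ cong (_* K) (*-assoc (fromℕ m) (expTerm M M) (fromℕ (M !))) ⟨
      fromℕ m * expTerm M M * fromℕ (M !) * K      ≡⟨ *-assoc (fromℕ m * expTerm M M) (fromℕ (M !)) K ⟩
      fromℕ m * expTerm M M * (fromℕ (M !) * K)    ≡⟨ cong (fromℕ m * expTerm M M *_) (*-comm (fromℕ (M !)) K) ⟩
      fromℕ m * expTerm M M * (K * fromℕ (M !)) ∎
      where open ≤-Reasoning

  -- Built with `mkℚ` instead of `_/_`, so that numerator and denominator are visible without
  -- normalisation.
  inverseSuc : ℕ → ℚ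
  inverseSuc k = mkℚ (+ 1) k (1-coprimeTo (suc k))

  1-inverseSuc : ∀ k → (1ℚ - inverseSuc k) * fromℕ (suc k) ≡ fromℕ k
  1-inverseSuc k = toℚᵘ-injective (begin-equality
    toℚᵘ ((1ℚ - inverseSuc k) * fromℕ (suc k))           ≃⟨ toℚᵘ-homo-* (1ℚ - inverseSuc k) (fromℕ (suc k)) ⟩
    toℚᵘ (1ℚ - inverseSuc k) ℚᵘ.* toℚᵘ (fromℕ (suc k))   ≃⟨ ℚᵘₚ.*-cong (toℚᵘ-homo-+ 1ℚ (ℚ.- inverseSuc k)) (toℚᵘ-fromℕ (suc k)) ⟩
    (mkℚᵘ (+ 1) 0 ℚᵘ.- mkℚᵘ (+ 1) k) ℚᵘ.* mkℚᵘ (+ suc k) 0  ≃⟨ *≡* cross ⟩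
    mkℚᵘ (+ k) 0                                         ≃⟨ toℚᵘ-fromℕ k ⟨
    toℚᵘ (fromℕ k) ∎)
    where
    open ℚᵘₚ.≤-Reasoning
    cross : (+ 1 ℤ.* + suc k ℤ.+ ℤ.- (+ 1) ℤ.* + 1) ℤ.* + suc k ℤ.* + 1 ≡ + k ℤ.* + (suc (k ℕ.+ 0) ℕ.* 1)
    cross rewrite ℕₚ.+-identityʳ k = trans (ℤₚ.*-identityʳ (+ k ℤ.* + suc k)) (cong (λ l → + k ℤ.* + l) (sym (ℕₚ.*-identityʳ (suc k))))

  -- A positive rational with denominator q is at least 1/q, and k + 1 exceeds q.
  inverseSuc-< : ∀ (δ : ℚ) → 0ℚ ℚ.< δ → ∀ k → ℚ.↧ₙ δ ℕ.≤ k → ℚ.∣ inverseSuc k ∣ ℚ.< δ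
  inverseSuc-< (mkℚ (+ suc p) q-1 _) _ k q≤k = ℚ.*<* (ℤ.+<+ (ℕₚ.≤-trans (ℕ.s≤s (ℕₚ.≤-trans (ℕₚ.≤-reflexive (ℕₚ.*-identityˡ (suc q-1))) q≤k)) (ℕₚ.m≤m+n (suc k) (p ℕ.* suc k))))
  inverseSuc-< (mkℚ (+ 0) q-1 _) (ℚ.*<* (ℤ.+<+ ())) k q≤k
  inverseSuc-< (mkℚ (ℤ.-[1+ n ]) q-1 _) (ℚ.*<* ()) k q≤k

-- Choice of the parameters and the set of orders

open import Defs
open Words using (words; length-words)
open Configurations
open Estimates
open Bound
open Rationals
open import Data.Nat as ℕ using (ℕ; zero; suc; _+_; _≤_; s≤s; z≤n; _∸_; _^_; _!; NonZero)
open import Data.Nat.Properties as ℕₚ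
open import Data.Nat.Tactic.RingSolver using (solve-∀)
open import Data.Fin using (Fin; toℕ; fromℕ<)
open import Data.Fin.Properties using (any?; toℕ-fromℕ<)
open import Data.List using (length)
open import Data.Product using (Σ; _×_; ∃; _,_)
open import Data.Sum using (inj₁; inj₂)
open import Data.Rational using (ℚ; _<_; _-_; _*_; ∣_∣; 0ℚ; 1ℚ; ↧ₙ_)
open import Relation.Nullary using (Dec; yes; no; contradiction)
open import Relation.Binary.PropositionalEquality

blockwise-transversals : ∀ k b d′ s .{{_ : NonZero s}} .{{_ : NonZero (b ^ d′)}} →
  let n = b ^ d′ ℕ.* s ; N = b ℕ.* n in
  (k ℕ.* n) ^ s ℕ.* n ≤ (suc k ℕ.* (n ∸ (s + s))) ^ s →
  ∃ λ m → TAtLeast (suc d′) N m ×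
    AtLeastOverExpPow m ((1ℚ - inverseSuc k) * fromℕ (N ^ d′)) (suc d′) N
blockwise-transversals k b d′ s {{s≢0}} rate = let m , t , le = many-transversals b d′ s in
  m , t , bound m le
  where
  n = b ^ d′ ℕ.* s
  N = b ℕ.* n
  bound : ∀ m → length (words (b ^ d′) s) ^ b ℕ.* (n !) ^ (b ℕ.* suc d′) ℕ.* fitRate b d′ s ^ (b ^ suc d′)
      ≤ m ℕ.* (n ! ℕ.* n !) ^ (b ^ suc d′) →
    AtLeastOverExpPow m ((1ℚ - inverseSuc k) * fromℕ (N ^ d′)) (suc d′) N
  bound m le = atLeastOverExpPow k (N ^ d′) m (suc d′) N (1ℚ - inverseSuc k) (1-inverseSuc k)
    (transversals-≥ k b d′ s (length (words (b ^ d′) s)) m {{s≢0}} {{m*n≢0 (b ^ d′) s}}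
      (m≤n*m s (b ^ d′)) (length-words (b ^ d′) s) le rate)

module _ (d′ : ℕ) (1≤d′ : 1 ≤ d′) where

  -- With q = base^d′, r = period, c = q r and t = 4c: cellSize = r t and side-length = c t ≤ 2^t.
  base gap period cellSize side-length order : ℕ → ℕ
  base k = 4 ℕ.* suc k
  gap k = base k ^ d′ ∸ base k
  period k = 2 ℕ.* suc k
  cellSize k = period k ℕ.* (4 ℕ.* (base k ^ d′ ℕ.* period k))
  side-length k = base k ^ d′ ℕ.* cellSize k
  order k = base k ℕ.* side-length k

  q≢0 : ∀ k → NonZero (base k ^ d′)
  q≢0 k = m^n≢0 (base k) d′

  c≢0 : ∀ k → NonZero (base k ^ d′ ℕ.* period k)
  c≢0 k = m*n≢0 (base k ^ d′) (period k) {{q≢0 k}}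

  cellSize≢0 : ∀ k → NonZero (cellSize k)
  cellSize≢0 k = m*n≢0 (period k) _ {{_}} {{m*n≢0 4 _ {{_}} {{c≢0 k}}}}

  side-length≢0 : ∀ k → NonZero (side-length k)
  side-length≢0 k = m*n≢0 (base k ^ d′) (cellSize k) {{q≢0 k}} {{cellSize≢0 k}}

  -- With q ≥ `base k` = 4 (k + 1), the loss 2/q is at most half of the permitted error 1/(k + 1).
  -- The other half leaves room for the factor 1 + 1/r in `rate-≤`, whose g is `gap k`.
  q≡2+ : ∀ k → base k ^ d′ ≡ 2 + (2 + 4 ℕ.* k + gap k)
  q≡2+ k = trans (sym (m+[n∸m]≡n {base k} (≤-trans (≤-reflexive (sym (*-identityʳ (base k)))) (^-monoʳ-≤ (base k) 1≤d′))))
    (cong (_+ gap k) (regroup k))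
    where
    regroup : ∀ k → 4 ℕ.* suc k ≡ 2 + (2 + 4 ℕ.* k)
    regroup = solve-∀

  side-length-≤ : ∀ k → side-length k ≤ 2 ^ (4 ℕ.* (base k ^ d′ ℕ.* period k))
  side-length-≤ k = ≤-trans (≤-reflexive (sym (*-assoc (base k ^ d′) (period k) _))) (*4*-≤-2^ (base k ^ d′ ℕ.* period k) {{c≢0 k}})

  rate-order : ∀ k → let s = cellSize k ; n = side-length k in
    (k ℕ.* n) ^ s ℕ.* n ≤ (suc k ℕ.* (n ∸ (s + s))) ^ s
  -- Only the factor q of n is brought into the form 2 + e that `rate-^-≤` expects; the power of
  -- `base k` hidden in `cellSize` and t stays as it is.
  rate-order k = subst (λ q → q ℕ.* cellSize k ≤ 2 ^ t → (k ℕ.* (q ℕ.* cellSize k)) ^ cellSize k ℕ.* (q ℕ.* cellSize k)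
      ≤ (suc k ℕ.* (q ℕ.* cellSize k ∸ (cellSize k + cellSize k))) ^ cellSize k)
    (sym (q≡2+ k)) (rate-^-≤ k (gap k) t) (side-length-≤ k)
    where t = 4 ℕ.* (base k ^ d′ ℕ.* period k)

  -- Makes the orders positive and unbounded, and confines the search for the index of an order N to
  -- numbers below N.
  suc≤order : ∀ k → suc k ≤ order k
  suc≤order k = ≤-trans (m≤m+n (suc k) _) (m≤m*n (base k) (side-length k) {{side-length≢0 k}})

  order-transversals : ∀ k → ∃ λ m → TAtLeast (suc d′) (order k) m ×
    AtLeastOverExpPow m ((1ℚ - inverseSuc k) * fromℕ (order k ^ d′)) (suc d′) (order k)
  order-transversals k = blockwise-transversals k (base k) d′ (cellSize k) {{cellSize≢0 k}} {{q≢0 k}} (rate-order k)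

module _ (seq : ℕ → ℕ) (suc≤seq : ∀ k → suc k ≤ seq k) where

  Value : ℕ → Set
  Value N = ∃ λ k → seq k ≡ N

  value? : ∀ N → Dec (∃ λ (i : Fin N) → seq (toℕ i) ≡ N)
  value? N = any? λ i → seq (toℕ i) ≟ N

  -- The index of an order is recovered by a bounded search. If several indices share the order, the
  -- one found is used throughout; 0 is a default outside the set.
  error : ℕ → ℚ
  error N with value? N
  ... | yes (i , _) = inverseSuc (toℕ i)
  ... | no _ = 0ℚ

  error-value : ∀ N → Value N → ∃ λ k → seq k ≡ N × error N ≡ inverseSuc k
  error-value N (k , eq) with value? N
  ... | yes (i , e) = toℕ i , e , refl
  ... | no ¬v = contradiction (fromℕ< k<N , trans (cong seq (toℕ-fromℕ< k<N)) eq) ¬v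
    where k<N = subst (suc k ≤_) eq (suc≤seq k)

  -- A crude common upper bound for the first J orders: an order exceeding it must have index at
  -- least J.
  partialSum : ℕ → ℕ
  partialSum zero = 0
  partialSum (suc j) = partialSum j + seq j

  seq≤partialSum : ∀ {j J} → j ℕ.< J → seq j ≤ partialSum J
  seq≤partialSum {j} {suc J} (s≤s j≤J) with m≤n⇒m<n∨m≡n j≤J
  ... | inj₁ j<J = ≤-trans (seq≤partialSum j<J) (m≤m+n (partialSum J) (seq J))
  ... | inj₂ refl = m≤n+m (seq j) (partialSum j)

  error-small : ∀ δ → 0ℚ < δ → ∃ λ M → ∀ N → Value N → M ≤ N → ∣ error N ∣ < δ
  -- An order beyond this threshold has index k at least the denominator of δ, as `inverseSuc-<`
  -- requires.
  error-small δ 0<δ = suc (partialSum (↧ₙ δ)) , small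
    where
    small : ∀ N → Value N → suc (partialSum (↧ₙ δ)) ≤ N → ∣ error N ∣ < δ
    small N v M≤N with k , refl , e ← error-value N v = subst (λ x → ∣ x ∣ < δ) (sym e)
      (inverseSuc-< δ 0<δ k (≮⇒≥ λ k<q → <⇒≱ M≤N (seq≤partialSum k<q)))

  value-≥1 : ∀ N → Value N → 1 ≤ N
  value-≥1 N (k , refl) = ≤-trans (s≤s z≤n) (suc≤seq k)

  value-unbounded : ∀ M → ∃ λ N → M ≤ N × Value N
  value-unbounded M = seq M , ≤-trans (n≤1+n M) (suc≤seq M) , M , refl

  error-bound : (P : ℕ → ℚ → Set) → (∀ k → P (seq k) (inverseSuc k)) → ∀ N → Value N → P N (error N)
  error-bound P p N v with k , refl , e ← error-value N v = subst (P N) (sym e) (p k)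

theorem4p1 : (d : ℕ) → 3 ≤ d →
    Σ (ℕ → Set) λ 𝒩 →
    ((N : ℕ) → 𝒩 N → 1 ≤ N) ×
    ((M : ℕ) → ∃ λ N → M ≤ N × 𝒩 N) ×
    Σ (ℕ → ℚ) λ ε →
    ((δ : ℚ) → 0ℚ < δ → ∃ λ M → (N : ℕ) → 𝒩 N → M ≤ N → ∣ ε N ∣ < δ) ×
    ((N : ℕ) → 𝒩 N →
    ∃ λ (m : ℕ) → TAtLeast d N m ×
    AtLeastOverExpPow m ((1ℚ - ε N) * fromℕ (N ^ (d ∸ 1))) d N)
theorem4p1 (suc d′) (s≤s 2≤d′) =
  Value seq suc≤seq , value-≥1 seq suc≤seq , value-unbounded seq suc≤seq ,
  error seq suc≤seq , error-small seq suc≤seq ,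
  error-bound seq suc≤seq
    (λ N ε → ∃ λ m → TAtLeast (suc d′) N m × AtLeastOverExpPow m ((1ℚ - ε) * fromℕ (N ^ d′)) (suc d′) N)
    (order-transversals d′ 1≤d′)
  where
  1≤d′ = ≤-trans (s≤s z≤n) 2≤d′
  seq = order d′ 1≤d′
  suc≤seq = suc≤order d′ 1≤d′
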